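{- Let $m,u\ge 2$, $p\ge 1$ and $n,v\ge 0$ be integers. For integers $N,M,j\ge 0$ let $\mathcal{A}_p(N,M,j)$ denote the set of all $N$-tuples $(a_1,\dots,a_N)$ of positive integer multiples of $p$ with $a_1+\dots+a_N=Mp$ and such that exactly $j$ of the entries $a_s$ are even multiples of $p$ (i.e. of the form $rp$ with $r$ even). Then in $\mathfrak{h}_t^1$ $$ \begin{aligned} z_m z_p^n \overset{t}{\ast} z_u z_p^v ={}&\sum_{l=1}^{n}\ \sum_{k=0}^{\min\{v,n-l\}}\ \sum_{\substack{i+j=k\\ i,j\ge 0}}\ \sum_{(a_1,\dots,a_N)\in\mathcal{A}_p(N,\,n+v-l,\,j)} \binom{v+n-l-2k}{v-k}(t^2-t)^i(1-2t)^j\\ &\quad\times z_m\Big\{z_p^l z_u+(1-2t)z_p^{l-1}z_{u+p}+(1-\delta_{v,0}\delta_{n,l})(t^2-t)z_p^{l-1}x^{u+p}\Big\}\, z_{a_1}\cdots z_{a_N}\\ &+\sum_{l=1}^{v}\ \sum_{k=0}^{\min\{n,v-l\}}\ \sum_{\substack{i+j=k\\ i,j\ge 0}}\ \sum_{(a_1,\dots,a_N)\in\mathcal{A}_p(N,\,n+v-l,\,j)} \binom{v+n-l-2k}{n-k}(t^2-t)^i(1-2t)^j\\ &\quad\times z_u\Big\{z_p^l z_m+(1-2t)z_p^{l-1}z_{m+p}+(1-\delta_{n,0}\delta_{v,l})(t^2-t)z_p^{l-1}x^{m+p}\Big\}\, z_{a_1}\cdots z_{a_N}\\ &+\sum_{k=0}^{\min\{n,v\}}\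 \sum_{\substack{i+j=k\\ i,j\ge 0}}\ \sum_{(a_1,\dots,a_{N'})\in\mathcal{A}_p(N',\,n+v,\,j)} \binom{v+n-2k}{n-k}(t^2-t)^i(1-2t)^j\\ &\quad\times \Big[z_m z_u+z_u z_m+(1-2t)z_{m+u}+(1-\delta_{n,0}\delta_{v,0})(t^2-t)x^{m+u}\Big]\, z_{a_1}\cdots z_{a_{N'}}, \end{aligned} $$ where $N=v+n-l-i-k$ in the first two sums and $N'=v+n-i-k$ in the third.
   Context: Let $A=\{x,y\}$ be two noncommuting letters, $A^*$ the set of all words in $A$ including the empty word $1$, and $\mathfrak{h}_t=\mathbb{Q}[t]\langle A\rangle$ the noncommutative polynomial algebra over $\mathbb{Q}[t]$ generated by $A$ (product = concatenation). Put $\mathfrak{h}_t^1=\mathbb{Q}[t]+\mathfrak{h}_t y$ and, for each positive integer $k$, $z_k=x^{k-1}y$. The t-stuffle product $\overset{t}{\ast}$ on $\mathfrak{h}_t^1$ is the $\mathbb{Q}[t]$-bilinear product determined by: (i) $1\overset{t}{\ast}w=w\overset{t}{\ast}1=w$; (ii) $$z_kw_1\overset{t}{\ast} z_lw_2 = z_k(w_1\overset{t}{\ast} z_lw_2) + z_l(z_kw_1\overset{t}{\ast} w_2)+(1-2t)z_{k+l}(w_1\overset{t}{\ast} w_2)+ [1-\delta(w_1)\delta(w_2)](t^2-t)x^{k+l}(w_1\overset{t}{\ast} w_2)$$ for all words $w,w_1,w_2\in A^*\cap\mathfrak{h}_t^1$ and all positive integers $k,l$, where $\delta(w)=1$ if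 $w=1$ and $\delta(w)=0$ otherwise. $z_p^n$ is the $n$-fold concatenation power, $z_p^0=1$; $\delta_{i,j}$ is Kronecker's delta. Empty sums are $0$; an empty product $z_{a_1}\cdots z_{a_N}$ with $N=0$ is $1$ (and $\mathcal{A}_p(0,0,0)$ consists of the empty tuple, while $\mathcal{A}_p(0,M,j)$ is empty for $(M,j)\neq(0,0)$). -}

module Defs where

open import Algebra.Bundles using (RawRing)
import Algebra.Definitions.RawSemiring as RawSemiringDefs
open import Data.Bool.Base using (if_then_else_)
open import Data.List.Base
  using (List; []; _∷_; _++_; map; foldr; filter; null; upTo; applyUpTo; cartesianProductWith; replicate)
open import Data.List.Properties using (≡-dec)
open import Data.Maybe.Base using (Maybe; just; nothing; _>>=_)
import Data.Maybe.Base as Maybe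
open import Data.Nat.Base using (ℕ; zero; suc; _∸_; _<_)
import Data.Nat.Base as ℕ
open import Data.Nat.Divisibility using (_∣_; _∣?_)
open import Data.Nat.Properties using (_≟_; _<?_)
open import Data.Product.Base using (_×_; _,_)
import Data.Rational.Base as ℚ
open import Data.Vec.Base using (Vec; toList; sum; count)
import Data.Vec.Base as Vec
open import Data.Vec.Relation.Unary.All using (All; all?)
open import Level using (0ℓ)
open import Relation.Binary.Definitions using (DecidableEquality)
open import Relation.Binary.PropositionalEquality using (_≡_; refl)
open import Relation.Nullary.Decidable using (does; yes; no; _×-dec_)
open import Relation.Unary using (Decidable)

-- The monoid algebra R[M].  An element is a formal sum, i.e. a list of
-- terms (coefficient , monomial) in which monomials may repeat; two elements
-- are equal when all their coefficients agree.
module MonoidAlgebra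
  (R : RawRing 0ℓ 0ℓ) {M : Set} (_≟ᴹ_ : DecidableEquality M)
  (_∙_ : M → M → M) (ε : M) where

  private module R = RawRing R

  FormalSum : Set
  FormalSum = List (R.Carrier × M)

  coeff : FormalSum → M → R.Carrier
  coeff []            w = R.0#
  coeff ((a , u) ∷ f) w = (if does (u ≟ᴹ w) then a else R.0#) R.+ coeff f w

  monomial : M → FormalSum
  monomial u = (R.1# , u) ∷ []

  infixr 7 _•_
  _•_ : R.Carrier → FormalSum → FormalSum
  c • f = map (λ (a , u) → c R.* a , u) f

  algebra : RawRing 0ℓ 0ℓ
  algebra = record
    { Carrier = FormalSum
    ; _≈_     = λ f g → ∀ w → coeff f w R.≈ coeff g w
    ; _+_     = _++_
    ; _*_     = cartesianProductWith (λ (a , u) (b , v) → a R.* b , u ∙ v)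
    ; -_      = map (λ (a , u) → R.- a , u)
    ; 0#      = []
    ; 1#      = monomial ε
    }

-- ℚ[t] is the monoid algebra of (ℕ, +, 0) over ℚ, with n standing for tⁿ.

module ℚ[t]-Algebra = MonoidAlgebra ℚ.+-*-rawRing _≟_ ℕ._+_ 0

ℚ[t]-rawRing : RawRing 0ℓ 0ℓ
ℚ[t]-rawRing = ℚ[t]-Algebra.algebra

open RawRing ℚ[t]-rawRing public using () renaming
  ( Carrier to ℚ[t]; _+_ to _+ᵗ_; _*_ to _*ᵗ_; -_ to -ᵗ_; 0# to 0ᵗ; 1# to 1ᵗ )

open RawSemiringDefs (RawRing.rawSemiring ℚ[t]-rawRing) public using () renaming
  ( _^_ to _^ᵗ_; _×_ to _×ᵗ_ )

infixl 6 _-ᵗ_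
_-ᵗ_ : ℚ[t] → ℚ[t] → ℚ[t]
f -ᵗ g = f +ᵗ (-ᵗ g)

t : ℚ[t]
t = ℚ[t]-Algebra.monomial 1

1-2t : ℚ[t]
1-2t = 1ᵗ -ᵗ (2 ×ᵗ t)

t²-t : ℚ[t]
t²-t = (t ^ᵗ 2) -ᵗ t

fromℕ : ℕ → ℚ[t]
fromℕ n = n ×ᵗ 1ᵗ

δ : ℕ → ℕ → ℚ[t]
δ i j = if does (i ≟ j) then 1ᵗ else 0ᵗ

-- ℌ = ℚ[t]⟨x, y⟩ is the monoid algebra of the free monoid on two letters.

data Letter : Set where
  X Y : Letter

_≟ᴸ_ : DecidableEquality Letter
X ≟ᴸ X = yes refl
X ≟ᴸ Y = no λ ()
Y ≟ᴸ X = no λ ()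
Y ≟ᴸ Y = yes refl

Word : Set
Word = List Letter

module ℌ-Algebra = MonoidAlgebra ℚ[t]-rawRing (≡-dec _≟ᴸ_) _++_ []

ℌ-rawRing : RawRing 0ℓ 0ℓ
ℌ-rawRing = ℌ-Algebra.algebra

open RawRing ℌ-rawRing public using (_≈_) renaming
  ( Carrier to ℌ; _+_ to _⊕_; _*_ to _·_; 0# to 0ᴴ; 1# to 1ᴴ )

open RawSemiringDefs (RawRing.rawSemiring ℌ-rawRing) public using (_^_)

open ℌ-Algebra public using (_•_)

x y : ℌ
x = ℌ-Algebra.monomial (X ∷ [])
y = ℌ-Algebra.monomial (Y ∷ [])

-- Only meaningful for k ≥ 1.
z : ℕ → ℌ
z k = x ^ (k ∸ 1) · y

z-product : List ℕ → ℌ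
z-product = foldr (λ k f → z k · f) 1ᴴ

∑ : {A : Set} → List A → (A → ℌ) → ℌ
∑ as f = foldr (λ a s → f a ⊕ s) 0ᴴ as

-- The words lying in ℌ¹ = ℚ[t] + ℌy (those that are empty or end in y) are
-- exactly the words z_{k₁}⋯z_{kᵣ} with all kᵢ ≥ 1, and this factorisation is
-- unique.  factor returns the list of the kᵢ, or nothing for a word not in ℌ¹.
factor : Word → Maybe (List ℕ)
factor []      = just []
factor (Y ∷ w) = Maybe.map (1 ∷_) (factor w)
factor (X ∷ w) = factor w >>= λ where
  []       → nothing
  (k ∷ ks) → just (suc k ∷ ks)

δ₁ : List ℕ → ℚ[t]
δ₁ ks = if null ks then 1ᵗ else 0ᵗ

-- The t-stuffle product of z_{k₁}⋯z_{kᵣ} and z_{l₁}⋯z_{lₛ}.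
stuffle : List ℕ → List ℕ → ℌ
stuffle []       ls       = z-product ls
stuffle (k ∷ ks) []       = z-product (k ∷ ks)
stuffle (k ∷ ks) (l ∷ ls) =
    z k · stuffle ks (l ∷ ls)
  ⊕ z l · stuffle (k ∷ ks) ls
  ⊕ 1-2t • (z (k ℕ.+ l) · stuffle ks ls)
  ⊕ ((1ᵗ -ᵗ δ₁ ks *ᵗ δ₁ ls) *ᵗ t²-t) • (x ^ (k ℕ.+ l) · stuffle ks ls)

stuffleʷ : Word → Word → ℌ
stuffleʷ w₁ w₂ with factor w₁ | factor w₂
... | just ks | just ls = stuffle ks ls
... | _       | _       = 0ᴴ

-- The ℚ[t]-bilinear extension.  The t-stuffle product lives on ℌ¹; here it
-- is extended to all of ℌ by the value 0 on words outside ℌ¹.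
infix 5 _⊛_
_⊛_ : ℌ → ℌ → ℌ
f ⊛ g = ∑ f λ (a , w₁) → ∑ g λ (b , w₂) → (a *ᵗ b) • stuffleʷ w₁ w₂

infix 6 _⋯_
_⋯_ : ℕ → ℕ → List ℕ
a ⋯ b = applyUpTo (a ℕ.+_) (suc b ∸ a)

-- All (i , j) with i + j = k.
antidiagonal : ℕ → List (ℕ × ℕ)
antidiagonal k = map (λ i → i , k ∸ i) (0 ⋯ k)

PositiveMultiple : ℕ → ℕ → Set
PositiveMultiple p a = 0 < a × p ∣ a

positiveMultiple? : ∀ p → Decidable (PositiveMultiple p)
positiveMultiple? p a = (0 <? a) ×-dec (p ∣? a)

evenMultiple? : ∀ p → Decidable (2 ℕ.* p ∣_)
evenMultiple? p a = (2 ℕ.* p) ∣? a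

In𝒜 : ∀ p N M j → Vec ℕ N → Set
In𝒜 p N M j as =
  All (PositiveMultiple p) as × sum as ≡ M ℕ.* p × count (evenMultiple? p) as ≡ j

in𝒜? : ∀ p N M j → Decidable (In𝒜 p N M j)
in𝒜? p N M j as =
  all? (positiveMultiple? p) as ×-dec (sum as ≟ M ℕ.* p)
    ×-dec (count (evenMultiple? p) as ≟ j)

tuples : List ℕ → ∀ N → List (Vec ℕ N)
tuples es zero    = Vec.[] ∷ []
tuples es (suc N) = cartesianProductWith Vec._∷_ es (tuples es N)

-- The finite set 𝒜_p(N,M,j), each element listed once.  No tuple is missed,
-- since the entries of a tuple with sum Mp are at most Mp.
𝒜 : ∀ p N M j → List (Vec ℕ N)
𝒜 p N M j = filter (in𝒜? p N M j) (tuples (0 ⋯ (M ℕ.* p)) N)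

z⃗ : ∀ {N} → Vec ℕ N → ℌ
z⃗ as = z-product (toList as)

{-# OPTIONS --safe #-}
module Submission where

-- The recursion of the t-stuffle product unfolds z_p^n ∗ z_u z_p^v and z_m z_p^n ∗ z_p^v
-- letter by letter until only products z_p^n ∗ z_p^v are left.  Write b = 1 − 2t and
-- c = t² − t.  The product z_p^n ∗ z_p^v is the coefficient of r^n s^v in the solution of
-- F = 1 + ((r + s) z_p + b r s z_2p) F + c r s x^2p (F − 1), that is, in
-- Σ_N (Σ_q (c r s)^q x^2pq ((r + s) z_p + b r s z_2p))^N, in which an odd multiple (2q+1)p
-- carries (c r s)^q (r + s) and an even one (2q+2)p carries (c r s)^q b r s.  In finite
-- terms: a tuple in 𝒜 is empty, starts with p, starts with 2p, or arises from one with
-- a smaller sum by adding 2p to its first entry, and with Pascal's rule this case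
-- distinction shows that the claimed sums satisfy the recursion of z_p^n ∗ z_p^v.

-- The coordinates explain the shape of the claim. In a summand with index k put e = n - k and f = v
-- - k: of the e + f odd multiples, e carry r and f carry s, hence the binomial coefficient, and
-- each of the k = i + j factors r s comes with c (i times, one for each 2p added to an entry) or
-- with b (j times, one for each even entry). Each case of the distinction on the first entry lowers
-- a single one of e, f, i, j: the entry p lowers e or f, the entry 2p lowers j, the addition of 2p
-- lowers i. The exception 1 - δδ, which turns F into F - 1, makes this exact: 2p can be added to
-- the first entry of a nonempty tuple only, so x^2p has no counterpart once both words are used up.
-- For fixed n and v the sum over k runs along a diagonal (e - s, f - s, k + s), on which e + f +
-- 2k, and with it the exceptional coefficient, is constant. The argument takes place in an
-- arbitrary algebra with arbitrary x, y, b, c; formal sums form such an algebra up to equality of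
-- coefficients.

open import Algebra.Bundles using (RawRing; Semiring; Ring; CommutativeRing)
open import Algebra.Core using (Op₂)
import Algebra.Definitions.RawSemiring as RawSemiringDefs
import Algebra.Properties.CommutativeSemigroup as CommutativeSemigroupProperties
import Algebra.Properties.Ring as RingProperties
import Algebra.Properties.Semiring.Mult as Mult
import Algebra.Solver.CommutativeMonoid as CommutativeMonoidSolver
open import Algebra.Structures using (IsMonoid; IsRing; IsCommutativeRing)
open import Data.Bool.Base using (if_then_else_)
open import Data.List.Base
  using (List; []; _∷_; _++_; map; foldr; filter; length; null; replicate; applyUpTo; concatMap)
open import Data.List.Membership.Propositional using (_∈_)
open import Data.List.Membership.Propositional.Properties
  using ( ∈-++⁺ˡ; ∈-++⁺ʳ; ∈-++⁻; ∈-map⁺; ∈-map⁻; ∈-filter⁺; ∈-filter⁻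
        ; ∈-applyUpTo⁺; ∈-applyUpTo⁻; ∈-cartesianProductWith⁺)
open import Data.List.Membership.Propositional.Properties.WithK using (unique∧set⇒bag)
open import Data.List.Properties
  using (filter-none; filter-reject; length-filter; map-applyUpTo; ≡-dec; ++-assoc; ++-isMonoid)
open import Data.List.Relation.Binary.BagAndSetEquality using (∼bag⇒↭)
open import Data.List.Relation.Binary.Permutation.Propositional as Perm using (_↭_)
import Data.List.Relation.Unary.All as List
import Data.List.Relation.Unary.All.Properties as List
open import Data.List.Relation.Unary.Any using (here; there)
open import Data.List.Relation.Unary.Unique.Propositional using (Unique; []; _∷_)
import Data.List.Relation.Unary.Unique.Propositional.Properties as Unique
open import Data.Maybe.Base as Maybe using (just; nothing)
open import Data.Nat.Base as ℕ
  using (ℕ; zero; suc; _∸_; _⊓_; _≤_; _<_; z≤n; s≤s; NonZero; >-nonZero)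
open import Data.Nat.Combinatorics using (_C_; nCn≡1; nCk+nC[k+1]≡[n+1]C[k+1])
open import Data.Nat.Divisibility using (_∣_; divides; ∣-refl; ∣⇒≤; ∣m∣n⇒∣m+n; ∣m+n∣m⇒∣n)
open import Data.Nat.Properties as ℕ using (_≟_; ≤-trans; <⇒≱; <⇒≢; m≤m+n; m≤n+m; m<m+n)
open import Data.Nat.Tactic.RingSolver using (solve-∀)
open import Data.Product.Base using (_×_; _,_; proj₁; proj₂; map₁)
import Data.Rational.Base as ℚ
import Data.Rational.Properties as ℚ
open import Data.Sum.Base using (inj₁; inj₂)
open import Data.Vec.Base using (Vec; []; _∷_; toList; sum; count)
open import Data.Vec.Properties using (∷-injective; ∷-injectiveˡ; ∷-injectiveʳ; count≤n)
open import Data.Vec.Relation.Unary.All as Vec using (All; []; _∷_)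
open import Defs using (module MonoidAlgebra; In𝒜; in𝒜?; 𝒜; tuples; evenMultiple?; _⋯_; antidiagonal)
open import Function.Base using (_∘_; id)
open import Function.Bundles using (mk⇔)
open import Level using (0ℓ)
open import Relation.Binary.Definitions using (DecidableEquality)
open import Relation.Binary.PropositionalEquality as ≡ using (_≡_; _≢_)
import Relation.Binary.Reasoning.Setoid as SetoidReasoning
open import Relation.Binary.Structures using (IsEquivalence)
open import Relation.Nullary.Decidable using (does; yes; no; ¬?; dec-true; dec-false)
open import Relation.Nullary.Negation using (¬_; contradiction)

-- The ring laws of monoid algebras

module MonoidAlgebraProperties
  {R : RawRing 0ℓ 0ℓ}
  (isCommutativeRing : IsCommutativeRing (RawRing._≈_ R) (RawRing._+_ R) (RawRing._*_ R)
                         (RawRing.-_ R) (RawRing.0# R) (RawRing.1# R))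
  {M : Set} (_≟_ : DecidableEquality M)
  {_∙_ : Op₂ M} {ε : M} (isMonoid : IsMonoid _≡_ _∙_ ε) where

  private
    commutativeRing : CommutativeRing 0ℓ 0ℓ
    commutativeRing = record { isCommutativeRing = isCommutativeRing }

    open CommutativeRing commutativeRing hiding (isCommutativeRing; isRing)
    open RingProperties ring using (-0#≈0#; -‿distribˡ-*; -‿+-comm)
    open CommutativeSemigroupProperties +-commutativeSemigroup
      using (interchange; x∙yz≈y∙xz)
    module * = CommutativeSemigroupProperties *-commutativeSemigroup
    module M = IsMonoid isMonoid

  open MonoidAlgebra R _≟_ _∙_ ε
  open RawRing algebra using () renaming
    (_≈_ to _≋_; _+_ to _⊞_; _*_ to _⊠_; -_ to ⊟_; 0# to 0ᴬ; 1# to 1ᴬ)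
  open SetoidReasoning setoid

  -- A formal sum acts on functions M → R, and equality of coefficients is the
  -- same as equality of these actions (⟨⟩-cong, ⟨⟩-ext); the laws of the
  -- algebra are checked on the actions.
  ⟨_,_⟩ : FormalSum → (M → Carrier) → Carrier
  ⟨ [] , φ ⟩          = 0#
  ⟨ (a , u) ∷ f , φ ⟩ = a * φ u + ⟨ f , φ ⟩

  indicator : M → M → Carrier
  indicator w u = if does (u ≟ w) then 1# else 0#

  coeff≈⟨⟩ : ∀ f w → coeff f w ≈ ⟨ f , indicator w ⟩
  coeff≈⟨⟩ []            w = refl
  coeff≈⟨⟩ ((a , u) ∷ f) w with u ≟ w
  ... | yes _ = +-cong (sym (*-identityʳ a)) (coeff≈⟨⟩ f w)
  ... | no _  = +-cong (sym (zeroʳ a)) (coeff≈⟨⟩ f w)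

  ⟨⟩-ext : ∀ f g → (∀ φ → ⟨ f , φ ⟩ ≈ ⟨ g , φ ⟩) → f ≋ g
  ⟨⟩-ext f g f~g w = begin
    coeff f w              ≈⟨ coeff≈⟨⟩ f w ⟩
    ⟨ f , indicator w ⟩    ≈⟨ f~g (indicator w) ⟩
    ⟨ g , indicator w ⟩    ≈⟨ coeff≈⟨⟩ g w ⟨
    coeff g w              ∎

  ⟨⟩-congʳ : ∀ f {φ ψ} → (∀ u → φ u ≈ ψ u) → ⟨ f , φ ⟩ ≈ ⟨ f , ψ ⟩
  ⟨⟩-congʳ []            φ≈ψ = refl
  ⟨⟩-congʳ ((a , u) ∷ f) φ≈ψ = +-cong (*-congˡ (φ≈ψ u)) (⟨⟩-congʳ f φ≈ψ)

  ⟨⟩-+ : ∀ f φ ψ → ⟨ f , (λ u → φ u + ψ u) ⟩ ≈ ⟨ f , φ ⟩ + ⟨ f , ψ ⟩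
  ⟨⟩-+ []            φ ψ = sym (+-identityˡ 0#)
  ⟨⟩-+ ((a , u) ∷ f) φ ψ =
    trans (+-cong (distribˡ a _ _) (⟨⟩-+ f φ ψ)) (interchange _ _ _ _)

  ⟨⟩-* : ∀ f c φ → ⟨ f , (λ u → c * φ u) ⟩ ≈ c * ⟨ f , φ ⟩
  ⟨⟩-* []            c φ = sym (zeroʳ c)
  ⟨⟩-* ((a , u) ∷ f) c φ = begin
    a * (c * φ u) + ⟨ f , (λ u → c * φ u) ⟩  ≈⟨ +-cong (*.x∙yz≈y∙xz a c _) (⟨⟩-* f c φ) ⟩
    c * (a * φ u) + c * ⟨ f , φ ⟩            ≈⟨ distribˡ c _ _ ⟨
    c * (a * φ u + ⟨ f , φ ⟩)                ∎

  ⟨⟩-zero : ∀ f → ⟨ f , (λ _ → 0#) ⟩ ≈ 0#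
  ⟨⟩-zero []            = refl
  ⟨⟩-zero ((a , u) ∷ f) = trans (+-cong (zeroʳ a) (⟨⟩-zero f)) (+-identityˡ 0#)

  ⟨++⟩ : ∀ f g φ → ⟨ f ++ g , φ ⟩ ≈ ⟨ f , φ ⟩ + ⟨ g , φ ⟩
  ⟨++⟩ []            g φ = sym (+-identityˡ _)
  ⟨++⟩ ((a , u) ∷ f) g φ = trans (+-congˡ (⟨++⟩ f g φ)) (sym (+-assoc _ _ _))

  ⟨-⟩ : ∀ f φ → ⟨ ⊟ f , φ ⟩ ≈ - ⟨ f , φ ⟩
  ⟨-⟩ []            φ = sym -0#≈0#
  ⟨-⟩ ((a , u) ∷ f) φ =
    trans (+-cong (sym (-‿distribˡ-* a _)) (⟨-⟩ f φ)) (-‿+-comm _ _)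

  ⟨•⟩ : ∀ c f φ → ⟨ c • f , φ ⟩ ≈ c * ⟨ f , φ ⟩
  ⟨•⟩ c []            φ = sym (zeroʳ c)
  ⟨•⟩ c ((a , u) ∷ f) φ =
    trans (+-cong (*-assoc c a _) (⟨•⟩ c f φ)) (sym (distribˡ c _ _))

  ⟨*⟩ : ∀ f g φ → ⟨ f ⊠ g , φ ⟩ ≈ ⟨ f , (λ u → ⟨ g , (λ v → φ (u ∙ v)) ⟩) ⟩
  ⟨*⟩ []            g φ = refl
  ⟨*⟩ ((a , u) ∷ f) g φ = trans (⟨++⟩ (map _ g) (f ⊠ g) φ) (+-cong (go g) (⟨*⟩ f g φ))
    where
    go : ∀ g → ⟨ map (λ (b , v) → a * b , u ∙ v) g , φ ⟩ ≈ a * ⟨ g , (λ v → φ (u ∙ v)) ⟩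
    go []            = sym (zeroʳ a)
    go ((b , v) ∷ g) = trans (+-cong (*-assoc a b _) (go g)) (sym (distribˡ a _ _))

  ⟨⟩-swap : ∀ f g (φ : M → M → Carrier) →
    ⟨ f , (λ u → ⟨ g , φ u ⟩) ⟩ ≈ ⟨ g , (λ v → ⟨ f , (λ u → φ u v) ⟩) ⟩
  ⟨⟩-swap []            g φ = sym (⟨⟩-zero g)
  ⟨⟩-swap ((a , u) ∷ f) g φ = begin
    a * ⟨ g , φ u ⟩ + ⟨ f , (λ u → ⟨ g , φ u ⟩) ⟩
      ≈⟨ +-cong (sym (⟨⟩-* g a (φ u))) (⟨⟩-swap f g φ) ⟩
    ⟨ g , (λ v → a * φ u v) ⟩ + ⟨ g , (λ v → ⟨ f , (λ u → φ u v) ⟩) ⟩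
      ≈⟨ ⟨⟩-+ g _ _ ⟨
    ⟨ g , (λ v → a * φ u v + ⟨ f , (λ u → φ u v) ⟩) ⟩
      ∎

  without : M → FormalSum → FormalSum
  without u = filter (λ (_ , v) → ¬? (v ≟ u))

  -- Collects all terms with the monomial `u`, which may be scattered over the list, into one term
  -- with their total coefficient.
  ⟨⟩-split : ∀ f u φ → ⟨ f , φ ⟩ ≈ coeff f u * φ u + ⟨ without u f , φ ⟩
  ⟨⟩-split []            u φ = sym (trans (+-identityʳ _) (zeroˡ _))
  ⟨⟩-split ((a , v) ∷ f) u φ with v ≟ u
  ... | yes ≡.refl = begin
    a * φ u + ⟨ f , φ ⟩                                        ≈⟨ +-congˡ (⟨⟩-split f u φ) ⟩
    a * φ u + (coeff f u * φ u + ⟨ without u f , φ ⟩)          ≈⟨ +-assoc _ _ _ ⟨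
    a * φ u + coeff f u * φ u + ⟨ without u f , φ ⟩            ≈⟨ +-congʳ (distribʳ _ _ _) ⟨
    (a + coeff f u) * φ u + ⟨ without u f , φ ⟩                ∎
  ... | no _ = begin
    a * φ v + ⟨ f , φ ⟩                                        ≈⟨ +-congˡ (⟨⟩-split f u φ) ⟩
    a * φ v + (coeff f u * φ u + ⟨ without u f , φ ⟩)          ≈⟨ x∙yz≈y∙xz _ _ _ ⟩
    coeff f u * φ u + (a * φ v + ⟨ without u f , φ ⟩)          ≈⟨ +-congʳ (*-congʳ (+-identityˡ _)) ⟨
    (0# + coeff f u) * φ u + (a * φ v + ⟨ without u f , φ ⟩)   ∎

  -- Induction on a bound `n` for the length: the terms with the monomial of the head have total
  -- coefficient 0, so deleting them all preserves the action, keeps every coefficient 0 and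
  -- shortens the list.
  ⟨⟩-null : ∀ n f → length f ℕ.≤ n → (∀ w → coeff f w ≈ 0#) → ∀ φ → ⟨ f , φ ⟩ ≈ 0#
  ⟨⟩-null n       []            _         f≈0 φ = refl
  ⟨⟩-null (suc n) ((a , u) ∷ f) (s≤s ∣f∣≤n) f≈0 φ = begin
    ⟨ au∷f , φ ⟩                                 ≈⟨ split φ ⟩
    ⟨ without u au∷f , φ ⟩                       ≈⟨ ⟨⟩-null n (without u au∷f) shorter rest≈0 φ ⟩
    0#                                           ∎
    where
    au∷f = (a , u) ∷ f

    split : ∀ φ → ⟨ au∷f , φ ⟩ ≈ ⟨ without u au∷f , φ ⟩
    split φ = begin
      ⟨ au∷f , φ ⟩                                      ≈⟨ ⟨⟩-split au∷f u φ ⟩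
      coeff au∷f u * φ u + ⟨ without u au∷f , φ ⟩       ≈⟨ +-congʳ (trans (*-congʳ (f≈0 u)) (zeroˡ _)) ⟩
      0# + ⟨ without u au∷f , φ ⟩                       ≈⟨ +-identityˡ _ ⟩
      ⟨ without u au∷f , φ ⟩                            ∎

    rest≈0 : ∀ w → coeff (without u au∷f) w ≈ 0#
    rest≈0 w = begin
      coeff (without u au∷f) w             ≈⟨ coeff≈⟨⟩ (without u au∷f) w ⟩
      ⟨ without u au∷f , indicator w ⟩     ≈⟨ split (indicator w) ⟨
      ⟨ au∷f , indicator w ⟩               ≈⟨ coeff≈⟨⟩ au∷f w ⟨
      coeff au∷f w                         ≈⟨ f≈0 w ⟩
      0#                                   ∎

    P? = λ (_ , v) → ¬? (v ≟ u)

    shorter : length (without u au∷f) ℕ.≤ n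
    shorter = ≡.subst (λ g → length g ℕ.≤ n)
      (≡.sym (filter-reject P? {x = a , u} {xs = f} (λ u≢u → u≢u ≡.refl)))
      (ℕ.≤-trans (length-filter P? f) ∣f∣≤n)

  coeff-++ : ∀ f g w → coeff (f ++ g) w ≈ coeff f w + coeff g w
  coeff-++ f g w = begin
    coeff (f ++ g) w                             ≈⟨ coeff≈⟨⟩ (f ++ g) w ⟩
    ⟨ f ++ g , indicator w ⟩                     ≈⟨ ⟨++⟩ f g (indicator w) ⟩
    ⟨ f , indicator w ⟩ + ⟨ g , indicator w ⟩    ≈⟨ +-cong (coeff≈⟨⟩ f w) (coeff≈⟨⟩ g w) ⟨
    coeff f w + coeff g w                        ∎

  coeff-- : ∀ f w → coeff (⊟ f) w ≈ - coeff f w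
  coeff-- f w = begin
    coeff (⊟ f) w              ≈⟨ coeff≈⟨⟩ (⊟ f) w ⟩
    ⟨ ⊟ f , indicator w ⟩      ≈⟨ ⟨-⟩ f (indicator w) ⟩
    - ⟨ f , indicator w ⟩      ≈⟨ -‿cong (coeff≈⟨⟩ f w) ⟨
    - coeff f w                ∎

  ⟨⟩-cong : ∀ f g → f ≋ g → ∀ φ → ⟨ f , φ ⟩ ≈ ⟨ g , φ ⟩
  ⟨⟩-cong f g f≋g φ = begin
    ⟨ f , φ ⟩                                  ≈⟨ +-identityʳ _ ⟨
    ⟨ f , φ ⟩ + 0#                             ≈⟨ +-congˡ (-‿inverseˡ _) ⟨
    ⟨ f , φ ⟩ + (- ⟨ g , φ ⟩ + ⟨ g , φ ⟩)      ≈⟨ +-assoc _ _ _ ⟨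
    ⟨ f , φ ⟩ + - ⟨ g , φ ⟩ + ⟨ g , φ ⟩        ≈⟨ +-congʳ (+-congˡ (⟨-⟩ g φ)) ⟨
    ⟨ f , φ ⟩ + ⟨ ⊟ g , φ ⟩ + ⟨ g , φ ⟩        ≈⟨ +-congʳ (⟨++⟩ f (⊟ g) φ) ⟨
    ⟨ f ++ ⊟ g , φ ⟩ + ⟨ g , φ ⟩               ≈⟨ +-congʳ (⟨⟩-null _ (f ++ ⊟ g) ℕ.≤-refl f-g≈0 φ) ⟩
    0# + ⟨ g , φ ⟩                             ≈⟨ +-identityˡ _ ⟩
    ⟨ g , φ ⟩                                  ∎
    where
    f-g≈0 : ∀ w → coeff (f ++ ⊟ g) w ≈ 0#
    f-g≈0 w = begin
      coeff (f ++ ⊟ g) w           ≈⟨ coeff-++ f (⊟ g) w ⟩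
      coeff f w + coeff (⊟ g) w    ≈⟨ +-cong (f≋g w) (coeff-- g w) ⟩
      coeff g w + - coeff g w      ≈⟨ -‿inverseʳ _ ⟩
      0#                           ∎

  ⟨monomial⟩ : ∀ u φ → ⟨ monomial u , φ ⟩ ≈ φ u
  ⟨monomial⟩ u φ = trans (+-identityʳ _) (*-identityˡ _)

  ≋-isEquivalence : IsEquivalence _≋_
  ≋-isEquivalence = record
    { refl  = λ w → refl
    ; sym   = λ f≋g w → sym (f≋g w)
    ; trans = λ f≋g g≋h w → trans (f≋g w) (g≋h w)
    }

  ⊞-cong : ∀ f f′ g g′ → f ≋ f′ → g ≋ g′ → (f ⊞ g) ≋ (f′ ⊞ g′)
  ⊞-cong f f′ g g′ f≋f′ g≋g′ w =
    trans (coeff-++ f g w) (trans (+-cong (f≋f′ w) (g≋g′ w)) (sym (coeff-++ f′ g′ w)))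

  ⊞-assoc : ∀ f g h → ((f ⊞ g) ⊞ h) ≋ (f ⊞ (g ⊞ h))
  ⊞-assoc f g h = ⟨⟩-ext ((f ⊞ g) ⊞ h) (f ⊞ (g ⊞ h)) λ φ → begin
    ⟨ (f ++ g) ++ h , φ ⟩                  ≈⟨ trans (⟨++⟩ (f ++ g) h φ) (+-congʳ (⟨++⟩ f g φ)) ⟩
    ⟨ f , φ ⟩ + ⟨ g , φ ⟩ + ⟨ h , φ ⟩      ≈⟨ +-assoc _ _ _ ⟩
    ⟨ f , φ ⟩ + (⟨ g , φ ⟩ + ⟨ h , φ ⟩)    ≈⟨ trans (⟨++⟩ f (g ++ h) φ) (+-congˡ (⟨++⟩ g h φ)) ⟨
    ⟨ f ++ (g ++ h) , φ ⟩                  ∎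

  ⊞-comm : ∀ f g → (f ⊞ g) ≋ (g ⊞ f)
  ⊞-comm f g w = trans (coeff-++ f g w) (trans (+-comm _ _) (sym (coeff-++ g f w)))

  ⊟-cong : ∀ f g → f ≋ g → (⊟ f) ≋ (⊟ g)
  ⊟-cong f g f≋g w = trans (coeff-- f w) (trans (-‿cong (f≋g w)) (sym (coeff-- g w)))

  ⊟-inverseˡ : ∀ f → ((⊟ f) ⊞ f) ≋ 0ᴬ
  ⊟-inverseˡ f w = trans (coeff-++ (⊟ f) f w) (trans (+-congʳ (coeff-- f w)) (-‿inverseˡ _))

  -- This is where arbitrary test functions are needed: for fixed `g`, the product is tested on `f`
  -- by a function of `u` that is no indicator even when φ is one.
  ⊠-cong : ∀ f f′ g g′ → f ≋ f′ → g ≋ g′ → (f ⊠ g) ≋ (f′ ⊠ g′)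
  ⊠-cong f f′ g g′ f≋f′ g≋g′ = ⟨⟩-ext (f ⊠ g) (f′ ⊠ g′) λ φ → begin
    ⟨ f ⊠ g , φ ⟩                                   ≈⟨ ⟨*⟩ f g φ ⟩
    ⟨ f , (λ u → ⟨ g , (λ v → φ (u ∙ v)) ⟩) ⟩       ≈⟨ ⟨⟩-cong f f′ f≋f′ _ ⟩
    ⟨ f′ , (λ u → ⟨ g , (λ v → φ (u ∙ v)) ⟩) ⟩      ≈⟨ ⟨⟩-congʳ f′ (λ u → ⟨⟩-cong g g′ g≋g′ _) ⟩
    ⟨ f′ , (λ u → ⟨ g′ , (λ v → φ (u ∙ v)) ⟩) ⟩     ≈⟨ ⟨*⟩ f′ g′ φ ⟨
    ⟨ f′ ⊠ g′ , φ ⟩                                 ∎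

  ⊠-assoc : ∀ f g h → ((f ⊠ g) ⊠ h) ≋ (f ⊠ (g ⊠ h))
  ⊠-assoc f g h = ⟨⟩-ext ((f ⊠ g) ⊠ h) (f ⊠ (g ⊠ h)) λ φ → begin
    ⟨ (f ⊠ g) ⊠ h , φ ⟩
      ≈⟨ trans (⟨*⟩ (f ⊠ g) h φ) (⟨*⟩ f g _) ⟩
    ⟨ f , (λ u → ⟨ g , (λ v → ⟨ h , (λ w → φ ((u ∙ v) ∙ w)) ⟩) ⟩) ⟩
      ≈⟨ ⟨⟩-congʳ f (λ u → ⟨⟩-congʳ g λ v → ⟨⟩-congʳ h λ w → reflexive (≡.cong φ (M.assoc u v w))) ⟩
    ⟨ f , (λ u → ⟨ g , (λ v → ⟨ h , (λ w → φ (u ∙ (v ∙ w))) ⟩) ⟩) ⟩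
      ≈⟨ trans (⟨*⟩ f (g ⊠ h) φ) (⟨⟩-congʳ f λ u → ⟨*⟩ g h _) ⟨
    ⟨ f ⊠ (g ⊠ h) , φ ⟩
      ∎

  ⊠-identityˡ : ∀ f → (1ᴬ ⊠ f) ≋ f
  ⊠-identityˡ f = ⟨⟩-ext (1ᴬ ⊠ f) f λ φ → begin
    ⟨ 1ᴬ ⊠ f , φ ⟩                  ≈⟨ trans (⟨*⟩ 1ᴬ f φ) (⟨monomial⟩ ε (λ u → ⟨ f , (λ v → φ (u ∙ v)) ⟩)) ⟩
    ⟨ f , (λ v → φ (ε ∙ v)) ⟩       ≈⟨ ⟨⟩-congʳ f (λ v → reflexive (≡.cong φ (M.identityˡ v))) ⟩
    ⟨ f , φ ⟩                       ∎

  ⊠-identityʳ : ∀ f → (f ⊠ 1ᴬ) ≋ f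
  ⊠-identityʳ f = ⟨⟩-ext (f ⊠ 1ᴬ) f λ φ → begin
    ⟨ f ⊠ 1ᴬ , φ ⟩                  ≈⟨ trans (⟨*⟩ f 1ᴬ φ) (⟨⟩-congʳ f λ u → ⟨monomial⟩ ε (λ v → φ (u ∙ v))) ⟩
    ⟨ f , (λ u → φ (u ∙ ε)) ⟩       ≈⟨ ⟨⟩-congʳ f (λ u → reflexive (≡.cong φ (M.identityʳ u))) ⟩
    ⟨ f , φ ⟩                       ∎

  ⊠-distribˡ-⊞ : ∀ f g h → (f ⊠ (g ⊞ h)) ≋ ((f ⊠ g) ⊞ (f ⊠ h))
  ⊠-distribˡ-⊞ f g h = ⟨⟩-ext (f ⊠ (g ⊞ h)) ((f ⊠ g) ⊞ (f ⊠ h)) λ φ → begin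
    ⟨ f ⊠ (g ⊞ h) , φ ⟩
      ≈⟨ trans (⟨*⟩ f (g ⊞ h) φ) (⟨⟩-congʳ f λ u → ⟨++⟩ g h _) ⟩
    ⟨ f , (λ u → ⟨ g , (λ v → φ (u ∙ v)) ⟩ + ⟨ h , (λ v → φ (u ∙ v)) ⟩) ⟩
      ≈⟨ ⟨⟩-+ f _ _ ⟩
    ⟨ f , (λ u → ⟨ g , (λ v → φ (u ∙ v)) ⟩) ⟩ + ⟨ f , (λ u → ⟨ h , (λ v → φ (u ∙ v)) ⟩) ⟩
      ≈⟨ trans (⟨++⟩ (f ⊠ g) (f ⊠ h) φ) (+-cong (⟨*⟩ f g φ) (⟨*⟩ f h φ)) ⟨
    ⟨ (f ⊠ g) ⊞ (f ⊠ h) , φ ⟩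
      ∎

  ⊠-distribʳ-⊞ : ∀ f g h → ((g ⊞ h) ⊠ f) ≋ ((g ⊠ f) ⊞ (h ⊠ f))
  ⊠-distribʳ-⊞ f g h = ⟨⟩-ext ((g ⊞ h) ⊠ f) ((g ⊠ f) ⊞ (h ⊠ f)) λ φ → begin
    ⟨ (g ⊞ h) ⊠ f , φ ⟩
      ≈⟨ trans (⟨*⟩ (g ⊞ h) f φ) (⟨++⟩ g h _) ⟩
    ⟨ g , (λ u → ⟨ f , (λ v → φ (u ∙ v)) ⟩) ⟩ + ⟨ h , (λ u → ⟨ f , (λ v → φ (u ∙ v)) ⟩) ⟩
      ≈⟨ trans (⟨++⟩ (g ⊠ f) (h ⊠ f) φ) (+-cong (⟨*⟩ g f φ) (⟨*⟩ h f φ)) ⟨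
    ⟨ (g ⊠ f) ⊞ (h ⊠ f) , φ ⟩
      ∎

  isRing : IsRing _≋_ _⊞_ _⊠_ ⊟_ 0ᴬ 1ᴬ
  isRing = record
    { +-isAbelianGroup = record
      { isGroup = record
        { isMonoid = record
          { isSemigroup = record
            { isMagma = record
              { isEquivalence = ≋-isEquivalence
              ; ∙-cong = λ {f} {f′} {g} {g′} → ⊞-cong f f′ g g′
              }
            ; assoc = ⊞-assoc
            }
          ; identity = (λ f w → refl)
                     , (λ f w → trans (coeff-++ f [] w) (+-identityʳ _))
          }
        ; inverse = ⊟-inverseˡ
                  , (λ f w → trans (⊞-comm f (⊟ f) w) (⊟-inverseˡ f w))
        ; ⁻¹-cong = λ {f} {g} → ⊟-cong f g
        }
      ; comm = ⊞-comm
      }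
    ; *-cong     = λ {f} {f′} {g} {g′} → ⊠-cong f f′ g g′
    ; *-assoc    = ⊠-assoc
    ; *-identity = ⊠-identityˡ , ⊠-identityʳ
    ; distrib    = ⊠-distribˡ-⊞ , ⊠-distribʳ-⊞
    }

  ⊠-comm : (∀ u v → u ∙ v ≡ v ∙ u) → ∀ f g → (f ⊠ g) ≋ (g ⊠ f)
  ⊠-comm ∙-comm f g = ⟨⟩-ext (f ⊠ g) (g ⊠ f) λ φ → begin
    ⟨ f ⊠ g , φ ⟩                                  ≈⟨ ⟨*⟩ f g φ ⟩
    ⟨ f , (λ u → ⟨ g , (λ v → φ (u ∙ v)) ⟩) ⟩      ≈⟨ ⟨⟩-swap f g _ ⟩
    ⟨ g , (λ v → ⟨ f , (λ u → φ (u ∙ v)) ⟩) ⟩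
      ≈⟨ ⟨⟩-congʳ g (λ v → ⟨⟩-congʳ f λ u → reflexive (≡.cong φ (∙-comm u v))) ⟩
    ⟨ g , (λ v → ⟨ f , (λ u → φ (v ∙ u)) ⟩) ⟩      ≈⟨ ⟨*⟩ g f φ ⟨
    ⟨ g ⊠ f , φ ⟩                                  ∎

  •-cong : ∀ {a a′} f f′ → a ≈ a′ → f ≋ f′ → (a • f) ≋ (a′ • f′)
  •-cong {a} {a′} f f′ a≈a′ f≋f′ = ⟨⟩-ext (a • f) (a′ • f′) λ φ →
    trans (⟨•⟩ a f φ) (trans (*-cong a≈a′ (⟨⟩-cong f f′ f≋f′ φ)) (sym (⟨•⟩ a′ f′ φ)))

  •-distribˡ : ∀ a f g → (a • (f ⊞ g)) ≋ ((a • f) ⊞ (a • g))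
  •-distribˡ a f g = ⟨⟩-ext (a • (f ⊞ g)) ((a • f) ⊞ (a • g)) λ φ → begin
    ⟨ a • (f ⊞ g) , φ ⟩              ≈⟨ trans (⟨•⟩ a (f ⊞ g) φ) (*-congˡ (⟨++⟩ f g φ)) ⟩
    a * (⟨ f , φ ⟩ + ⟨ g , φ ⟩)      ≈⟨ distribˡ a _ _ ⟩
    a * ⟨ f , φ ⟩ + a * ⟨ g , φ ⟩
      ≈⟨ trans (⟨++⟩ (a • f) (a • g) φ) (+-cong (⟨•⟩ a f φ) (⟨•⟩ a g φ)) ⟨
    ⟨ (a • f) ⊞ (a • g) , φ ⟩        ∎

  •-distribʳ : ∀ a b f → ((a + b) • f) ≋ ((a • f) ⊞ (b • f))
  •-distribʳ a b f = ⟨⟩-ext ((a + b) • f) ((a • f) ⊞ (b • f)) λ φ → begin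
    ⟨ (a + b) • f , φ ⟩              ≈⟨ ⟨•⟩ (a + b) f φ ⟩
    (a + b) * ⟨ f , φ ⟩              ≈⟨ distribʳ _ a b ⟩
    a * ⟨ f , φ ⟩ + b * ⟨ f , φ ⟩
      ≈⟨ trans (⟨++⟩ (a • f) (b • f) φ) (+-cong (⟨•⟩ a f φ) (⟨•⟩ b f φ)) ⟨
    ⟨ (a • f) ⊞ (b • f) , φ ⟩        ∎

  •-assoc : ∀ a b f → ((a * b) • f) ≋ (a • (b • f))
  •-assoc a b f = ⟨⟩-ext ((a * b) • f) (a • (b • f)) λ φ → begin
    ⟨ (a * b) • f , φ ⟩              ≈⟨ ⟨•⟩ (a * b) f φ ⟩
    a * b * ⟨ f , φ ⟩                ≈⟨ *-assoc a b _ ⟩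
    a * (b * ⟨ f , φ ⟩)              ≈⟨ trans (⟨•⟩ a (b • f) φ) (*-congˡ (⟨•⟩ b f φ)) ⟨
    ⟨ a • (b • f) , φ ⟩              ∎

  •-identity : ∀ f → (1# • f) ≋ f
  •-identity f = ⟨⟩-ext (1# • f) f λ φ → trans (⟨•⟩ 1# f φ) (*-identityˡ _)

  •-zeroˡ : ∀ f → (0# • f) ≋ 0ᴬ
  •-zeroˡ f = ⟨⟩-ext (0# • f) 0ᴬ λ φ → trans (⟨•⟩ 0# f φ) (zeroˡ _)

  •-⊠-assoc : ∀ a f g → ((a • f) ⊠ g) ≋ (a • (f ⊠ g))
  •-⊠-assoc a f g = ⟨⟩-ext ((a • f) ⊠ g) (a • (f ⊠ g)) λ φ → begin
    ⟨ (a • f) ⊠ g , φ ⟩                                ≈⟨ trans (⟨*⟩ (a • f) g φ) (⟨•⟩ a f _) ⟩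
    a * ⟨ f , (λ u → ⟨ g , (λ v → φ (u ∙ v)) ⟩) ⟩      ≈⟨ trans (⟨•⟩ a (f ⊠ g) φ) (*-congˡ (⟨*⟩ f g φ)) ⟨
    ⟨ a • (f ⊠ g) , φ ⟩                                ∎

  ⊠-•-comm : ∀ a f g → (f ⊠ (a • g)) ≋ (a • (f ⊠ g))
  ⊠-•-comm a f g = ⟨⟩-ext (f ⊠ (a • g)) (a • (f ⊠ g)) λ φ → begin
    ⟨ f ⊠ (a • g) , φ ⟩
      ≈⟨ trans (⟨*⟩ f (a • g) φ) (⟨⟩-congʳ f λ u → ⟨•⟩ a g _) ⟩
    ⟨ f , (λ u → a * ⟨ g , (λ v → φ (u ∙ v)) ⟩) ⟩
      ≈⟨ ⟨⟩-* f a _ ⟩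
    a * ⟨ f , (λ u → ⟨ g , (λ v → φ (u ∙ v)) ⟩) ⟩
      ≈⟨ trans (⟨•⟩ a (f ⊠ g) φ) (*-congˡ (⟨*⟩ f g φ)) ⟨
    ⟨ a • (f ⊠ g) , φ ⟩
      ∎

-- The tuples of 𝒜 by their first entry

module _ where

  open import Data.Nat.Base using (_+_; _*_)
  open import Data.Nat.Properties
    using (+-assoc; +-identityʳ; +-cancelˡ-≡; +-mono-≤; *-cancelʳ-≤; ≤-refl)
  open ≡ using (refl; sym; trans; cong; subst)

  -- Multiplication of a generating function by its variable: the value at n is that of `f` at n -
  -- 1, with `∅` for the index -1. It lets the recursions below be stated without separate boundary
  -- cases.
  shift : {A : Set} → A → (ℕ → A) → ℕ → A
  shift ∅ f zero    = ∅
  shift ∅ f (suc n) = f n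

  shift-unique : {A : Set} {f : ℕ → List A} →
    (∀ n → Unique (f n)) → ∀ n → Unique (shift [] f n)
  shift-unique f! zero    = []
  shift-unique f! (suc n) = f! n

  bump : ∀ {N} → ℕ → Vec ℕ (suc N) → Vec ℕ (suc N)
  bump k (a ∷ as) = k + a ∷ as

  bump-injective : ∀ {N} k {as bs : Vec ℕ (suc N)} → bump k as ≡ bump k bs → as ≡ bs
  bump-injective k {a ∷ as} {b ∷ bs} eq
    with refl ← +-cancelˡ-≡ k a b (∷-injectiveˡ eq) | refl ← ∷-injectiveʳ eq = refl

  ∈-tuples⁺ : ∀ {es N} {as : Vec ℕ N} → All (_∈ es) as → as ∈ tuples es N
  ∈-tuples⁺ []           = here refl
  ∈-tuples⁺ (a∈es ∷ as∈) = ∈-cartesianProductWith⁺ _∷_ a∈es (∈-tuples⁺ as∈)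

  tuples-unique : ∀ {es} → Unique es → ∀ N → Unique (tuples es N)
  tuples-unique es! zero    = List.[] ∷ []
  tuples-unique es! (suc N) = Unique.cartesianProductWith⁺ _∷_ ∷-injective es! (tuples-unique es! N)

  entries≤sum : ∀ {N} (as : Vec ℕ N) → All (_≤ sum as) as
  entries≤sum []       = []
  entries≤sum (a ∷ as) = m≤m+n a (sum as) ∷ Vec.map (λ b≤ → ≤-trans b≤ (m≤n+m (sum as) a)) (entries≤sum as)

  ∈𝒜⇒In𝒜 : ∀ p {N} M j {as : Vec ℕ N} → as ∈ 𝒜 p N M j → In𝒜 p N M j as
  ∈𝒜⇒In𝒜 p {N} M j as∈ = proj₂ (∈-filter⁻ (in𝒜? p N M j) {xs = tuples (0 ⋯ (M * p)) N} as∈)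

  In𝒜⇒∈𝒜 : ∀ p {N} M j {as : Vec ℕ N} → In𝒜 p N M j as → as ∈ 𝒜 p N M j
  In𝒜⇒∈𝒜 p {N} M j {as} as∈@(_ , sum≡ , _) = ∈-filter⁺ (in𝒜? p N M j)
    (∈-tuples⁺ (Vec.map (λ a≤ → ∈-applyUpTo⁺ id (s≤s (subst (_ ≤_) sum≡ a≤))) (entries≤sum as))) as∈

  𝒜-unique : ∀ p N M j → Unique (𝒜 p N M j)
  𝒜-unique p N M j = Unique.filter⁺ (in𝒜? p N M j)
    (tuples-unique (Unique.applyUpTo⁺₁ id _ (λ i<j _ → <⇒≢ i<j)) N)

  𝒜-empty : ∀ p N M j → (∀ {as} → ¬ In𝒜 p N M j as) → 𝒜 p N M j ≡ []
  𝒜-empty p N M j none = filter-none (in𝒜? p N M j) {xs = tuples (0 ⋯ (M * p)) N}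
    (List.universal (λ _ → none) _)

  module _ (p : ℕ) (0<p : 0 < p) where

    private instance
      p≢0 : NonZero p
      p≢0 = >-nonZero 0<p

    2*p≡p+p : 2 * p ≡ p + p
    2*p≡p+p = cong (p +_) (+-identityʳ p)

    p≢p+p+ : ∀ a → p ≢ p + p + a
    p≢p+p+ a = <⇒≢ (subst (p <_) (sym (+-assoc p p a)) (m<m+n p (≤-trans 0<p (m≤m+n p a))))

    2p∤p : ¬ 2 * p ∣ p
    2p∤p 2p∣p = <⇒≱ (subst (p <_) (sym 2*p≡p+p) (m<m+n p 0<p)) (∣⇒≤ 2p∣p)

    2p∣p+p : 2 * p ∣ p + p
    2p∣p+p = subst (2 * p ∣_) 2*p≡p+p ∣-refl

    count-even : ∀ {N a} (as : Vec ℕ N) → 2 * p ∣ a →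
      count (evenMultiple? p) (a ∷ as) ≡ suc (count (evenMultiple? p) as)
    count-even {a = a} as 2p∣a = cong (λ b → (if b then suc else id) (count (evenMultiple? p) as))
      (dec-true (evenMultiple? p a) 2p∣a)

    count-odd : ∀ {N a} (as : Vec ℕ N) → ¬ 2 * p ∣ a →
      count (evenMultiple? p) (a ∷ as) ≡ count (evenMultiple? p) as
    count-odd {a = a} as 2p∤a = cong (λ b → (if b then suc else id) (count (evenMultiple? p) as))
      (dec-false (evenMultiple? p a) 2p∤a)

    -- Divisibility by 2p is unaffected by adding 2p. This is why large first entries are lowered by
    -- 2p rather than by p: the number j of even multiples stays the same.
    count-bump : ∀ {N} (as : Vec ℕ (suc N)) →
      count (evenMultiple? p) (bump (p + p) as) ≡ count (evenMultiple? p) as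
    count-bump (a ∷ as) with evenMultiple? p a
    ... | yes 2p∣a = count-even as (∣m∣n⇒∣m+n 2p∣p+p 2p∣a)
    ... | no 2p∤a  = count-odd as (λ 2p∣ → 2p∤a (∣m+n∣m⇒∣n 2p∣ 2p∣p+p))

    In𝒜-p∷ : ∀ {N} M j {as} → In𝒜 p N M j as → In𝒜 p (suc N) (suc M) j (p ∷ as)
    In𝒜-p∷ M j {as} (as⁺ , sum≡ , count≡) =
      (0<p , ∣-refl) ∷ as⁺ , cong (p +_) sum≡ , trans (count-odd as 2p∤p) count≡

    In𝒜-2p∷ : ∀ {N} M j {as} → In𝒜 p N M j as → In𝒜 p (suc N) (2 + M) (suc j) (p + p ∷ as)
    In𝒜-2p∷ M j {as} (as⁺ , sum≡ , count≡) =
        (≤-trans 0<p (m≤m+n p p) , ∣m∣n⇒∣m+n ∣-refl ∣-refl) ∷ as⁺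
      , trans (+-assoc p p (sum as)) (cong (λ s → p + (p + s)) sum≡)
      , trans (count-even as 2p∣p+p) (cong suc count≡)

    In𝒜-bump : ∀ {N} M j {as} → In𝒜 p (suc N) M j as → In𝒜 p (suc N) (2 + M) j (bump (p + p) as)
    In𝒜-bump M j {a ∷ as} ((_ , p∣a) ∷ as⁺ , sum≡ , count≡) =
        (≤-trans 0<p (≤-trans (m≤m+n p p) (m≤m+n (p + p) a)) , ∣m∣n⇒∣m+n (∣m∣n⇒∣m+n ∣-refl ∣-refl) p∣a) ∷ as⁺
      , trans (trans (+-assoc (p + p) a (sum as)) (+-assoc p p _)) (cong (λ s → p + (p + s)) sum≡)
      , trans (count-bump (a ∷ as)) count≡

    -- The three lists hold the tuples whose first entry is p, is 2p, or exceeds 2p. The entry 2p is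
    -- even and uses up one unit of j, hence its additional shift in `j`.
    byFirstEntry : ∀ N M j → List (Vec ℕ (suc N))
    byFirstEntry N M j =
         map (p ∷_) (shift [] (λ M → 𝒜 p N M j) M)
      ++ map (p + p ∷_) (shift [] (shift [] (λ M → shift [] (𝒜 p N M) j)) M)
      ++ map (bump (p + p)) (shift [] (shift [] (λ M → 𝒜 p (suc N) M j)) M)

    byFirstEntry⇒𝒜 : ∀ N M j {as} → as ∈ byFirstEntry N M j → as ∈ 𝒜 p (suc N) M j
    byFirstEntry⇒𝒜 N M j as∈ with ∈-++⁻ (map (p ∷_) (shift [] (λ M → 𝒜 p N M j) M)) as∈
    byFirstEntry⇒𝒜 N (suc M) j _ | inj₁ as∈
      with _ , bs∈ , refl ← ∈-map⁻ (p ∷_) as∈ = In𝒜⇒∈𝒜 p (suc M) j (In𝒜-p∷ M j (∈𝒜⇒In𝒜 p M j bs∈))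
    byFirstEntry⇒𝒜 N M j _ | inj₂ as∈
      with ∈-++⁻ (map (p + p ∷_) (shift [] (shift [] (λ M → shift [] (𝒜 p N M) j)) M)) as∈
    byFirstEntry⇒𝒜 N (suc (suc M)) (suc j) _ | inj₂ _ | inj₁ as∈
      with _ , bs∈ , refl ← ∈-map⁻ (p + p ∷_) as∈ = In𝒜⇒∈𝒜 p (2 + M) (suc j) (In𝒜-2p∷ M j (∈𝒜⇒In𝒜 p M j bs∈))
    byFirstEntry⇒𝒜 N (suc (suc M)) j _ | inj₂ _ | inj₂ as∈
      with _ , bs∈ , refl ← ∈-map⁻ (bump (p + p)) as∈ = In𝒜⇒∈𝒜 p (2 + M) j (In𝒜-bump M j (∈𝒜⇒In𝒜 p M j bs∈))

    𝒜⇒byFirstEntry : ∀ N M j {as} → In𝒜 p (suc N) M j as → as ∈ byFirstEntry N M j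
    𝒜⇒byFirstEntry N M j {a ∷ as} ((0<a , divides zero refl) ∷ _ , _) = contradiction refl (<⇒≢ 0<a)
    𝒜⇒byFirstEntry N zero j {a ∷ as} ((0<a , _) ∷ _ , sum≡ , _) =
      contradiction (sym sum≡) (<⇒≢ (≤-trans 0<a (m≤m+n a (sum as))))
    -- The quotient 1 gives the entry p + 0, and the quotient 2 below gives p + (p + 0); hence the
    -- transports to p and p + p.
    𝒜⇒byFirstEntry N (suc M) j {a ∷ as} ((_ , divides 1 refl) ∷ as⁺ , sum≡ , count≡) =
      subst (λ a → a ∷ as ∈ byFirstEntry N (suc M) j) (sym (+-identityʳ p))
        (∈-++⁺ˡ (∈-map⁺ (p ∷_) (In𝒜⇒∈𝒜 p M j (as⁺
          , +-cancelˡ-≡ p _ _ (trans (cong (_+ sum as) (sym (+-identityʳ p))) sum≡)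
          , trans (sym (count-odd as (λ 2p∣ → 2p∤p (subst (2 * p ∣_) (+-identityʳ p) 2p∣)))) count≡))))
    -- A first entry of at least 2p is incompatible with the sum p.
    𝒜⇒byFirstEntry N 1 j {a ∷ as} ((_ , divides (suc (suc r)) refl) ∷ _ , sum≡ , _) =
      contradiction (trans (sym (+-identityʳ p)) (trans (sym sum≡) (trans (+-assoc p (p + r * p) (sum as))
          (trans (cong (p +_) (+-assoc p (r * p) (sum as))) (sym (+-assoc p p _))))))
        (p≢p+p+ (r * p + sum as))
    𝒜⇒byFirstEntry N (suc (suc M)) j {a ∷ as} ((_ , divides 2 refl) ∷ as⁺ , sum≡ , count≡)
      with refl ← trans (sym (count-even as ∣-refl)) count≡ =
      subst (λ a → a ∷ as ∈ byFirstEntry N (suc (suc M)) j) (sym 2*p≡p+p)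
        (∈-++⁺ʳ (map (p ∷_) (𝒜 p N (suc M) j)) (∈-++⁺ˡ (∈-map⁺ (p + p ∷_) (In𝒜⇒∈𝒜 p M _ (as⁺
          , +-cancelˡ-≡ p _ _ (+-cancelˡ-≡ p _ _
              (trans (sym (+-assoc p p (sum as))) (trans (cong (_+ sum as) (sym 2*p≡p+p)) sum≡)))
          , refl)))))
    𝒜⇒byFirstEntry N (suc (suc M)) j {a ∷ as} ((_ , divides (suc (suc (suc r))) refl) ∷ as⁺ , sum≡ , count≡) =
      subst (λ a → a ∷ as ∈ byFirstEntry N (suc (suc M)) j) (+-assoc p p b)
        (∈-++⁺ʳ (map (p ∷_) (𝒜 p N (suc M) j))
          (∈-++⁺ʳ (map (p + p ∷_) (shift [] (𝒜 p N M) j)) (∈-map⁺ (bump (p + p)) (In𝒜⇒∈𝒜 p M j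
            ( (≤-trans 0<p (m≤m+n p _) , divides (suc r) refl) ∷ as⁺
            , +-cancelˡ-≡ p _ _ (+-cancelˡ-≡ p _ _
                (trans (sym (trans (+-assoc p (p + b) (sum as)) (cong (p +_) (+-assoc p b (sum as))))) sum≡))
            , trans (sym (count-bump (b ∷ as)))
                (trans (cong (λ a → count (evenMultiple? p) (a ∷ as)) (+-assoc p p b)) count≡))))))
      where b = suc r * p

    byFirstEntry-unique : ∀ N M j → Unique (byFirstEntry N M j)
    byFirstEntry-unique N M j =
      Unique.++⁺ (Unique.map⁺ ∷-injectiveʳ (shift-unique (λ M → 𝒜-unique p N M j) M))
        (Unique.++⁺ (Unique.map⁺ ∷-injectiveʳ (shift-unique (shift-unique λ M → shift-unique (𝒜-unique p N M) j) M))
          (Unique.map⁺ (bump-injective (p + p)) (shift-unique (shift-unique λ M → 𝒜-unique p (suc N) M j) M))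
          (λ (∈₁ , ∈₂) → 2p≢bump M ∈₁ ∈₂))
        (λ (∈₁ , ∈₂) → p≢∷ (shift [] (shift [] (λ M → shift [] (𝒜 p N M) j)) M) _ ∈₁ ∈₂)
      where
      2p≢bump : ∀ M {as} →
        as ∈ map (p + p ∷_) (shift [] (shift [] (λ M → shift [] (𝒜 p N M) j)) M) →
        ¬ as ∈ map (bump (p + p)) (shift [] (shift [] (λ M → 𝒜 p (suc N) M j)) M)
      2p≢bump (suc (suc M)) ∈₁ ∈₂
        with _ , _ , refl ← ∈-map⁻ (p + p ∷_) ∈₁ | a ∷ _ , bs∈ , eq ← ∈-map⁻ (bump (p + p)) ∈₂
        with (0<a , _) ∷ _ , _ ← ∈𝒜⇒In𝒜 p M j bs∈ = <⇒≢ (m<m+n (p + p) 0<a) (∷-injectiveˡ eq)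

      p≢∷ : ∀ {as xs} ys zs → as ∈ map (p ∷_) xs →
        ¬ as ∈ map (p + p ∷_) ys ++ map (bump (p + p)) zs
      p≢∷ ys zs ∈₁ ∈₂ with _ , _ , refl ← ∈-map⁻ (p ∷_) ∈₁ | ∈-++⁻ (map (p + p ∷_) ys) ∈₂
      ... | inj₁ ∈₃ with _ , _ , eq ← ∈-map⁻ (p + p ∷_) ∈₃ =
        p≢p+p+ 0 (trans (∷-injectiveˡ eq) (sym (+-identityʳ (p + p))))
      ... | inj₂ ∈₃ with a ∷ _ , _ , eq ← ∈-map⁻ (bump (p + p)) ∈₃ =
        p≢p+p+ a (∷-injectiveˡ eq)

    -- Two lists without repetitions and with the same members are permutations of each other, which
    -- is all that a sum over them requires.
    𝒜-step : ∀ N M j → 𝒜 p (suc N) M j ↭ byFirstEntry N M j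
    𝒜-step N M j = ∼bag⇒↭ (unique∧set⇒bag (𝒜-unique p (suc N) M j) (byFirstEntry-unique N M j)
      (mk⇔ (𝒜⇒byFirstEntry N M j ∘ ∈𝒜⇒In𝒜 p M j) (byFirstEntry⇒𝒜 N M j)))

    -- An even multiple contributes at least 2p and any other entry at least p, so each even entry
    -- counts twice.
    sum-bound : ∀ {N} (as : Vec ℕ N) → All (λ a → 0 < a × p ∣ a) as →
      (N + count (evenMultiple? p) as) * p ≤ sum as
    sum-bound [] [] = ≤-refl
    sum-bound {suc N} (a ∷ as) ((0<a , p∣a) ∷ as⁺) with evenMultiple? p a
    ... | yes 2p∣a = subst (_≤ a + sum as)
      (trans (cong (_+ (N + c) * p) 2*p≡p+p) (trans (+-assoc p p _) (cong (λ n → p + n * p) (sym (ℕ.+-suc N c)))))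
      (+-mono-≤ (∣⇒≤ {{>-nonZero 0<a}} 2p∣a) (sum-bound as as⁺))
      where c = count (evenMultiple? p) as
    ... | no _ = +-mono-≤ (∣⇒≤ {{>-nonZero 0<a}} p∣a) (sum-bound as as⁺)

    -- With N - j odd entries, this is the case of a negative number of odd entries.
    𝒜-empty₁ : ∀ N M j → N < j → 𝒜 p N M j ≡ []
    𝒜-empty₁ N M j N<j = 𝒜-empty p N M j λ { {as} (_ , _ , refl) →
      <⇒≱ N<j (count≤n (evenMultiple? p) as) }

    -- The least possible sum is (N + j)p; here the surplus over it would be negative.
    𝒜-empty₂ : ∀ N M j → M < N + j → 𝒜 p N M j ≡ []
    𝒜-empty₂ N M j M<N+j = 𝒜-empty p N M j λ { {as} (as⁺ , sum≡ , refl) →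
      <⇒≱ M<N+j (*-cancelʳ-≤ _ M p (≤-trans (sum-bound as as⁺) (ℕ.≤-reflexive sum≡))) }

    𝒜-empty₀ : ∀ M j → 𝒜 p 0 (suc M) j ≡ []
    𝒜-empty₀ M j = 𝒜-empty p 0 (suc M) j λ { {[]} (_ , 0≡p+ , _) →
      <⇒≢ (≤-trans 0<p (m≤m+n p (M * p))) 0≡p+ }

-- Products of powers in an arbitrary algebra

-- The ring is not assumed commutative, but scalars commute with each other and with all its
-- elements.
record Algebra : Set₁ where
  infixr 7 _•_
  field
    scalars : CommutativeRing 0ℓ 0ℓ
    ring    : Ring 0ℓ 0ℓ

  module K = CommutativeRing scalars
  open Ring ring hiding (zero)

  field
    _•_        : K.Carrier → Carrier → Carrier
    •-cong     : ∀ {a b f g} → a K.≈ b → f ≈ g → a • f ≈ b • g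
    •-distribˡ : ∀ a f g → a • (f + g) ≈ a • f + a • g
    •-distribʳ : ∀ a b f → (a K.+ b) • f ≈ a • f + b • f
    •-assoc    : ∀ a b f → (a K.* b) • f ≈ a • b • f
    •-identity : ∀ f → K.1# • f ≈ f
    •-zeroˡ    : ∀ f → K.0# • f ≈ 0#
    •-zeroʳ    : ∀ a → a • 0# ≈ 0#
    •-*-assoc  : ∀ a f g → (a • f) * g ≈ a • (f * g)
    *-•-comm   : ∀ a f g → f * (a • g) ≈ a • (f * g)

  •-congˡ : ∀ {a f g} → f ≈ g → a • f ≈ a • g
  •-congˡ = •-cong K.refl

  •-congʳ : ∀ {a b f} → a K.≈ b → a • f ≈ b • f
  •-congʳ a≈b = •-cong a≈b refl

-- Finite sums, shifted sequences and sums over antidiagonals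

module Sums (R : Ring 0ℓ 0ℓ) where
  open Ring R
  open CommutativeSemigroupProperties +-commutativeSemigroup using (interchange; x∙yz≈y∙xz)

  ∑ : {A : Set} → List A → (A → Carrier) → Carrier
  ∑ as f = foldr (λ a s → f a + s) 0# as

  private variable
    A B : Set

  ∑-cong-∈ : (as : List A) {f g : A → Carrier} → (∀ {a} → a ∈ as → f a ≈ g a) → ∑ as f ≈ ∑ as g
  ∑-cong-∈ []       f≈g = refl
  ∑-cong-∈ (a ∷ as) f≈g = +-cong (f≈g (here ≡.refl)) (∑-cong-∈ as (f≈g ∘ there))

  ∑-cong : (as : List A) {f g : A → Carrier} → (∀ a → f a ≈ g a) → ∑ as f ≈ ∑ as g
  ∑-cong as f≈g = ∑-cong-∈ as (λ {a} _ → f≈g a)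

  ∑-zero : (as : List A) → ∑ as (λ _ → 0#) ≈ 0#
  ∑-zero []       = refl
  ∑-zero (a ∷ as) = trans (+-identityˡ _) (∑-zero as)

  ∑-+ : (as : List A) (f g : A → Carrier) → ∑ as (λ a → f a + g a) ≈ ∑ as f + ∑ as g
  ∑-+ []       f g = sym (+-identityˡ 0#)
  ∑-+ (a ∷ as) f g = trans (+-congˡ (∑-+ as f g)) (interchange _ _ _ _)

  ∑-++ : (as bs : List A) (f : A → Carrier) → ∑ (as ++ bs) f ≈ ∑ as f + ∑ bs f
  ∑-++ []       bs f = sym (+-identityˡ _)
  ∑-++ (a ∷ as) bs f = trans (+-congˡ (∑-++ as bs f)) (sym (+-assoc _ _ _))

  ∑-map : (h : A → B) (as : List A) (f : B → Carrier) → ∑ (map h as) f ≡ ∑ as (f ∘ h)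
  ∑-map h []       f = ≡.refl
  ∑-map h (a ∷ as) f = ≡.cong (f (h a) +_) (∑-map h as f)

  ∑-↭ : {as bs : List A} → as ↭ bs → (f : A → Carrier) → ∑ as f ≈ ∑ bs f
  ∑-↭ Perm.refl           f = refl
  ∑-↭ (Perm.prep a p)     f = +-congˡ (∑-↭ p f)
  ∑-↭ (Perm.swap a b p)   f = trans (+-congˡ (+-congˡ (∑-↭ p f))) (x∙yz≈y∙xz _ _ _)
  ∑-↭ (Perm.trans p q)    f = trans (∑-↭ p f) (∑-↭ q f)

  *-distribˡ-∑ : (h : Carrier) (as : List A) (f : A → Carrier) → h * ∑ as f ≈ ∑ as (λ a → h * f a)
  *-distribˡ-∑ h []       f = zeroʳ h
  *-distribˡ-∑ h (a ∷ as) f = trans (distribˡ h _ _) (+-congˡ (*-distribˡ-∑ h as f))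

  ∑-applyUpTo : (g : ℕ → A) → ∀ n (f : A → Carrier) → ∑ (applyUpTo g n) f ≡ ∑ (applyUpTo id n) (f ∘ g)
  ∑-applyUpTo g n f =
    ≡.trans (≡.cong (λ as → ∑ as f) (≡.sym (map-applyUpTo id g n))) (∑-map g (applyUpTo id n) f)

  shift-cong : {f g : ℕ → Carrier} → (∀ n → f n ≈ g n) → ∀ n → shift 0# f n ≈ shift 0# g n
  shift-cong f≈g zero    = refl
  shift-cong f≈g (suc n) = f≈g n

  shift-zero : {f : ℕ → Carrier} → (∀ n → f n ≈ 0#) → ∀ n → shift 0# f n ≈ 0#
  shift-zero f≈0 zero    = refl
  shift-zero f≈0 (suc n) = f≈0 n

  shift²-zero : {f : ℕ → Carrier} → ∀ n → (∀ n′ → n ≡ 2 ℕ.+ n′ → f n′ ≈ 0#) →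
    shift 0# (shift 0# f) n ≈ 0#
  shift²-zero 0             f≈0 = refl
  shift²-zero 1             f≈0 = refl
  shift²-zero (suc (suc n)) f≈0 = f≈0 n ≡.refl

  ∑-shift : (g : ℕ → List A) (f : A → Carrier) → ∀ n → ∑ (shift [] g n) f ≈ shift 0# (λ n → ∑ (g n) f) n
  ∑-shift g f zero    = refl
  ∑-shift g f (suc n) = refl

  shift-∑ : (as : List A) (f : ℕ → A → Carrier) → ∀ n →
    ∑ as (λ a → shift 0# (λ n → f n a) n) ≈ shift 0# (λ n → ∑ as (f n)) n
  shift-∑ as f zero    = ∑-zero as
  shift-∑ as f (suc n) = refl

  ∈-antidiagonal : ∀ k {i j} → (i , j) ∈ antidiagonal k → i ℕ.+ j ≡ k
  ∈-antidiagonal k ij∈ with i , i∈ , ≡.refl ← ∈-map⁻ (λ i → i , k ∸ i) ij∈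
    with _ , s≤s i≤k , ≡.refl ← ∈-applyUpTo⁻ id i∈ = ℕ.m+[n∸m]≡n i≤k

  antidiagonal-suc : ∀ k → antidiagonal (suc k) ≡ (0 , suc k) ∷ map (map₁ suc) (antidiagonal k)
  antidiagonal-suc k = ≡.cong ((0 , suc k) ∷_) (≡.trans (map-applyUpTo suc _ (suc k))
    (≡.sym (≡.trans (≡.cong (map (map₁ suc)) (map-applyUpTo id _ (suc k)))
      (map-applyUpTo (λ i → i , k ∸ i) (map₁ suc) (suc k)))))

  ∑-antidiagonal-suc : ∀ k (f : ℕ × ℕ → Carrier) →
    ∑ (antidiagonal (suc k)) f ≡ f (0 , suc k) + ∑ (antidiagonal k) (f ∘ map₁ suc)
  ∑-antidiagonal-suc k f = ≡.trans (≡.cong (λ as → ∑ as f) (antidiagonal-suc k))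
    (≡.cong (f (0 , suc k) +_) (∑-map (map₁ suc) (antidiagonal k) f))

  -- The pair with i = 0 contributes 0, and lowering i maps the other pairs onto those with sum k -
  -- 1.
  ∑-antidiagonal-shiftˡ : ∀ k (h : ℕ → ℕ → Carrier) →
    ∑ (antidiagonal k) (λ (i , j) → shift 0# (λ i → h i j) i) ≈
    shift 0# (λ k → ∑ (antidiagonal k) (λ (i , j) → h i j)) k
  ∑-antidiagonal-shiftˡ zero    h = +-identityˡ 0#
  ∑-antidiagonal-shiftˡ (suc k) h = trans (reflexive (∑-antidiagonal-suc k _)) (+-identityˡ _)

  -- The pair that contributes 0 is now the last one, whereas `antidiagonal-suc` splits off the
  -- first; hence the induction.
  ∑-antidiagonal-shiftʳ : ∀ k (h : ℕ → ℕ → Carrier) →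
    ∑ (antidiagonal k) (λ (i , j) → shift 0# (h i) j) ≈
    shift 0# (λ k → ∑ (antidiagonal k) (λ (i , j) → h i j)) k
  ∑-antidiagonal-shiftʳ zero          h = +-identityˡ 0#
  ∑-antidiagonal-shiftʳ 1             h = +-congˡ (+-identityˡ 0#)
  ∑-antidiagonal-shiftʳ (suc (suc k)) h = trans (reflexive (∑-antidiagonal-suc (suc k) _))
    (trans (+-congˡ (∑-antidiagonal-shiftʳ (suc k) (h ∘ suc))) (reflexive (≡.sym (∑-antidiagonal-suc k _))))

-- The closed form for products of two powers of z_p and its recursion

module TupleSums (𝔸 : Algebra) (x y : Ring.Carrier (Algebra.ring 𝔸))
  (b c : CommutativeRing.Carrier (Algebra.scalars 𝔸)) where

  open Algebra 𝔸
  open Ring ring hiding (zero)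
  open Sums ring
  open SetoidReasoning setoid
  open RawSemiringDefs (Semiring.rawSemiring semiring) using (_^_)
  open RawSemiringDefs (Semiring.rawSemiring K.semiring) using () renaming (_^_ to _^ᴷ_; _×_ to _×ᴷ_)
  open CommutativeMonoidSolver +-commutativeMonoid using (solve; _⊜_; _⊕_)
  open CommutativeSemigroupProperties K.*-commutativeSemigroup using ()
    renaming (x∙yz≈y∙xz to *ᴷ-swap)

  z : ℕ → Carrier
  z k = x ^ (k ∸ 1) * y

  z-product : List ℕ → Carrier
  z-product = foldr (λ k f → z k * f) 1#

  z⃗ : ∀ {N} → Vec ℕ N → Carrier
  z⃗ as = z-product (toList as)

  -- Raising a first entry by k is left multiplication by x^k. Positivity of `a` matters: with
  -- truncated subtraction `z 0` equals `z 1`.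
  x^k*z : ∀ k {a} → 0 < a → z (k ℕ.+ a) ≈ x ^ k * z a
  x^k*z zero    0<a = sym (*-identityˡ _)
  x^k*z (suc k) {suc a} 0<a = begin
    x ^ (k ℕ.+ suc a) * y          ≡⟨ ≡.cong (λ n → x ^ n * y) (ℕ.+-suc k a) ⟩
    x * x ^ (k ℕ.+ a) * y          ≈⟨ *-assoc x _ y ⟩
    x * (x ^ (k ℕ.+ a) * y)        ≡⟨ ≡.cong (λ n → x * (x ^ (n ∸ 1) * y)) (ℕ.+-suc k a) ⟨
    x * z (k ℕ.+ suc a)            ≈⟨ *-congˡ (x^k*z k 0<a) ⟩
    x * (x ^ k * z (suc a))        ≈⟨ *-assoc x _ _ ⟨
    x * x ^ k * z (suc a)          ∎

  fromℕ : ℕ → K.Carrier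
  fromℕ n = n ×ᴷ K.1#

  δ : ℕ → ℕ → K.Carrier
  δ i j = if does (i ≟ j) then K.1# else K.0#

  -- κ r is the coefficient (1 − δ(w₁)δ(w₂))c for words w₁, w₂ with r letters z_k in all.
  κ : ℕ → K.Carrier
  κ zero    = K.0#
  κ (suc _) = c

  •-distribˡ-∑ : {A : Set} (a : K.Carrier) (as : List A) (f : A → Carrier) → a • ∑ as f ≈ ∑ as (λ s → a • f s)
  •-distribˡ-∑ a []       f = •-zeroʳ a
  •-distribˡ-∑ a (s ∷ as) f = trans (•-distribˡ a _ _) (+-congˡ (•-distribˡ-∑ a as f))

  module _ (p : ℕ) (0<p : 0 < p) where

    S : ℕ → ℕ → ℕ → Carrier
    S N M j = ∑ (𝒜 p N M j) z⃗

    ∑-bump : ∀ N M j → ∑ (map (bump (p ℕ.+ p)) (𝒜 p (suc N) M j)) z⃗ ≈ x ^ (p ℕ.+ p) * S (suc N) M j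
    ∑-bump N M j = begin
      ∑ (map (bump (p ℕ.+ p)) (𝒜 p (suc N) M j)) z⃗
        ≡⟨ ∑-map (bump (p ℕ.+ p)) (𝒜 p (suc N) M j) z⃗ ⟩
      ∑ (𝒜 p (suc N) M j) (z⃗ ∘ bump (p ℕ.+ p))
        ≈⟨ ∑-cong-∈ (𝒜 p (suc N) M j) (λ {as} as∈ → bumped as (∈𝒜⇒In𝒜 p M j as∈)) ⟩
      ∑ (𝒜 p (suc N) M j) (λ as → x ^ (p ℕ.+ p) * z⃗ as)
        ≈⟨ *-distribˡ-∑ _ (𝒜 p (suc N) M j) z⃗ ⟨
      x ^ (p ℕ.+ p) * S (suc N) M j
        ∎
      where
      bumped : ∀ as → In𝒜 p (suc N) M j as → z⃗ (bump (p ℕ.+ p) as) ≈ x ^ (p ℕ.+ p) * z⃗ as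
      bumped (a ∷ as) ((0<a , _) ∷ _ , _) = trans (*-congʳ (x^k*z (p ℕ.+ p) 0<a)) (*-assoc _ _ _)

    ∑-∷ : ∀ {N} a (ass : List (Vec ℕ N)) → ∑ (map (a ∷_) ass) z⃗ ≈ z a * ∑ ass z⃗
    ∑-∷ a ass = trans (reflexive (∑-map (a ∷_) ass z⃗)) (sym (*-distribˡ-∑ (z a) ass z⃗))

    S-step : ∀ N M j → S (suc N) M j ≈
        z p * shift 0# (λ M → S N M j) M
      + (z (p ℕ.+ p) * shift 0# (shift 0# (λ M → shift 0# (S N M) j)) M
      + x ^ (p ℕ.+ p) * shift 0# (shift 0# (λ M → S (suc N) M j)) M)
    S-step N M j = begin
      S (suc N) M j
        ≈⟨ ∑-↭ (𝒜-step p 0<p N M j) z⃗ ⟩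
      ∑ (byFirstEntry p 0<p N M j) z⃗
        ≈⟨ trans (∑-++ (map (p ∷_) odds) _ z⃗) (+-congˡ (∑-++ (map (p ℕ.+ p ∷_) evens) _ z⃗)) ⟩
      ∑ (map (p ∷_) odds) z⃗ + (∑ (map (p ℕ.+ p ∷_) evens) z⃗ + ∑ (map (bump (p ℕ.+ p)) larger) z⃗)
        ≈⟨ +-cong (trans (∑-∷ p odds) (*-congˡ (∑-shift (λ M → 𝒜 p N M j) z⃗ M)))
             (+-cong (trans (∑-∷ (p ℕ.+ p) evens) (*-congˡ ∑-evens)) (∑-larger M)) ⟩
      _ ∎
      where
      odds   = shift [] (λ M → 𝒜 p N M j) M
      evens  = shift [] (shift [] (λ M → shift [] (𝒜 p N M) j)) M
      larger = shift [] (shift [] (λ M → 𝒜 p (suc N) M j)) M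

      ∑-evens : ∑ evens z⃗ ≈ shift 0# (shift 0# (λ M → shift 0# (S N M) j)) M
      ∑-evens = trans (∑-shift _ z⃗ M) (shift-cong (λ M → trans (∑-shift _ z⃗ M)
        (shift-cong (λ M → ∑-shift (𝒜 p N M) z⃗ j) M)) M)

      ∑-larger : ∀ M → ∑ (map (bump (p ℕ.+ p)) (shift [] (shift [] (λ M → 𝒜 p (suc N) M j)) M)) z⃗
        ≈ x ^ (p ℕ.+ p) * shift 0# (shift 0# (λ M → S (suc N) M j)) M
      ∑-larger 0             = sym (zeroʳ _)
      ∑-larger 1             = sym (zeroʳ _)
      ∑-larger (suc (suc M)) = ∑-bump N M j

    ∑-empty : ∀ N M j → 𝒜 p N M j ≡ [] → S N M j ≈ 0#
    ∑-empty N M j 𝒜≡[] = reflexive (≡.cong (λ as → ∑ as z⃗) 𝒜≡[])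

    -- d odd and j even multiples of p; 2i is what is left after lowering them to p and 2p.
    T : ℕ → ℕ → ℕ → Carrier
    T d i j = S (d ℕ.+ j) (d ℕ.+ 2 ℕ.* (i ℕ.+ j)) j

    T-zero : T 0 0 0 ≈ 1#
    T-zero = +-identityʳ 1#

    T-zero-suc : ∀ i → T 0 (suc i) 0 ≈ 0#
    T-zero-suc i = ∑-empty 0 (2 ℕ.* (suc i ℕ.+ 0)) 0 (𝒜-empty₀ p 0<p (ℕ.pred (2 ℕ.* (suc i ℕ.+ 0))) 0)

    -- In the coordinates d, i, j the three cases of `S-step` each lower exactly one coordinate by
    -- 1: the entry p lowers d, the entry 2p lowers j, and removing 2p from a larger entry lowers i.
    -- Where a coordinate would become negative, the set of tuples is empty. The hypothesis says
    -- that the tuples have a first entry.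
    T-step : ∀ N d i j → suc N ≡ d ℕ.+ j → T d i j ≈
        z p * shift 0# (λ d → T d i j) d
      + (z (p ℕ.+ p) * shift 0# (T d i) j
      + x ^ (p ℕ.+ p) * shift 0# (λ i → T d i j) i)
    T-step N d i j 1+N≡d+j = begin
      T d i j
        ≡⟨ ≡.cong (λ N → S N (M d i j) j) 1+N≡d+j ⟨
      S (suc N) (M d i j) j
        ≈⟨ S-step N (M d i j) j ⟩
      _ ≈⟨ +-cong (*-congˡ (odds d 1+N≡d+j)) (+-cong (*-congˡ (evens j 1+N≡d+j)) (*-congˡ (larger i))) ⟩
      _ ∎
      where
      M : ℕ → ℕ → ℕ → ℕ
      M d i j = d ℕ.+ 2 ℕ.* (i ℕ.+ j)

      odds : ∀ d → suc N ≡ d ℕ.+ j → shift 0# (λ M → S N M j) (M d i j) ≈ shift 0# (λ d → T d i j) d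
      odds zero    1+N≡j   = shift-zero (λ M → ∑-empty N M j (𝒜-empty₁ p 0<p N M j (ℕ.≤-reflexive 1+N≡j))) (M 0 i j)
      odds (suc d) 1+N≡d+j = reflexive (≡.cong (λ N → S N (M d i j) j) (ℕ.suc-injective 1+N≡d+j))

      evens : ∀ j → suc N ≡ d ℕ.+ j →
        shift 0# (shift 0# (λ M → shift 0# (S N M) j)) (M d i j) ≈ shift 0# (T d i) j
      evens zero    _       = shift-zero (shift-zero (λ _ → refl)) (M d i 0)
      evens (suc j) 1+N≡d+j = begin
        shift 0# (shift 0# (λ M → S N M j)) (M d i (suc j))
          ≡⟨ ≡.cong (shift 0# (shift 0# (λ M → S N M j))) (M-suc d i j) ⟩
        S N (M d i j) j
          ≡⟨ ≡.cong (λ N → S N (M d i j) j) (ℕ.suc-injective (≡.trans 1+N≡d+j (ℕ.+-suc d j))) ⟩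
        T d i j ∎
        where
        M-suc : ∀ d i j → d ℕ.+ 2 ℕ.* (i ℕ.+ suc j) ≡ 2 ℕ.+ (d ℕ.+ 2 ℕ.* (i ℕ.+ j))
        M-suc = solve-∀

      larger : ∀ i → shift 0# (shift 0# (λ M → S (suc N) M j)) (M d i j) ≈ shift 0# (λ i → T d i j) i
      -- For i = 0 the sum is already the least possible one, (N + 1 + j)p, so nothing is left after
      -- subtracting 2p.
      larger zero    = shift²-zero (M d 0 j) (λ M′ M≡2+M′ →
        ∑-empty (suc N) M′ j (𝒜-empty₂ p 0<p (suc N) M′ j (ℕ.≤-trans (ℕ.m≤n+m (suc M′) 1) (ℕ.≤-reflexive
          (≡.trans (≡.sym M≡2+M′) (≡.trans (2*-+ d j) (≡.cong (ℕ._+ j) (≡.sym 1+N≡d+j))))))))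
        where
        2*-+ : ∀ d j → d ℕ.+ 2 ℕ.* j ≡ d ℕ.+ j ℕ.+ j
        2*-+ = solve-∀
      larger (suc i) = begin
        shift 0# (shift 0# (λ M → S (suc N) M j)) (M d (suc i) j)
          ≡⟨ ≡.cong (shift 0# (shift 0# (λ M → S (suc N) M j))) (M-suc d i j) ⟩
        S (suc N) (M d i j) j
          ≡⟨ ≡.cong (λ N → S N (M d i j) j) 1+N≡d+j ⟩
        T d i j ∎
        where
        M-suc : ∀ d i j → d ℕ.+ 2 ℕ.* (suc i ℕ.+ j) ≡ 2 ℕ.+ (d ℕ.+ 2 ℕ.* (i ℕ.+ j))
        M-suc = solve-∀

    -- The binomial coefficient counts the ways to distribute e factors r and f factors s over the e
    -- + f odd entries.
    w : ℕ → ℕ → ℕ → ℕ → K.Carrier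
    w e f i j = fromℕ ((e ℕ.+ f) C e) K.* c ^ᴷ i K.* b ^ᴷ j

    W : ℕ → ℕ → ℕ → ℕ → Carrier
    W e f i j = w e f i j • T (e ℕ.+ f) i j

    w-pascal : ∀ e f i j → w (suc e) (suc f) i j K.≈ w e (suc f) i j K.+ w (suc e) f i j
    w-pascal e f i j = K.trans (K.*-congʳ (K.trans (K.*-congʳ pascal) (K.distribʳ _ _ _))) (K.distribʳ _ _ _)
      where
      module × = Mult K.semiring
      pascal : fromℕ ((suc e ℕ.+ suc f) C suc e) K.≈
               fromℕ ((e ℕ.+ suc f) C e) K.+ fromℕ ((suc e ℕ.+ f) C suc e)
      pascal = K.trans (K.reflexive (≡.cong fromℕ (≡.trans (≡.sym (nCk+nC[k+1]≡[n+1]C[k+1] (e ℕ.+ suc f) e))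
          (≡.cong (λ n → (e ℕ.+ suc f) C e ℕ.+ n C suc e) (ℕ.+-suc e f)))))
        (×.×-homo-+ K.1# ((e ℕ.+ suc f) C e) ((suc e ℕ.+ f) C suc e))

    -- Pascal's rule on the border f = 0, where only one of its two summands exists.
    w-diagonal : ∀ e i j → w (suc e) 0 i j ≡ w e 0 i j
    w-diagonal e i j = ≡.cong (λ n → fromℕ n K.* c ^ᴷ i K.* b ^ᴷ j) (≡.trans (C-diag (suc e)) (≡.sym (C-diag e)))
      where
      C-diag : ∀ e → (e ℕ.+ 0) C e ≡ 1
      C-diag e = ≡.trans (≡.cong (_C e) (ℕ.+-identityʳ e)) (nCn≡1 e)

    w-evens : ∀ e f i j → w e f i (suc j) K.≈ b K.* w e f i j
    w-evens e f i j = *ᴷ-swap _ b _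

    w-larger : ∀ e f i j → w e f (suc i) j K.≈ c K.* w e f i j
    w-larger e f i j = K.trans (K.*-congʳ (*ᴷ-swap _ c _)) (K.*-assoc c _ _)

    W-zero : W 0 0 0 0 ≈ 1#
    W-zero = trans
      (•-cong (K.trans (K.*-identityʳ _) (K.trans (K.*-identityʳ _) (K.+-identityʳ _))) T-zero)
      (•-identity 1#)

    W-zero-suc : ∀ i → W 0 0 (suc i) 0 ≈ 0#
    W-zero-suc i = trans (•-congˡ (T-zero-suc i)) (•-zeroʳ _)

    -- A first entry p carries r or s, which lowers e or f; Pascal's rule splits the binomial
    -- coefficient accordingly.
    W-odds : ∀ e f i j → w e f i j • (z p * shift 0# (λ d → T d i j) (e ℕ.+ f)) ≈
      z p * (shift 0# (λ e → W e f i j) e + shift 0# (λ f → W e f i j) f)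
    W-odds e f i j = trans (sym (*-•-comm _ _ _)) (*-congˡ (odds e f))
      where
      odds : ∀ e f → w e f i j • shift 0# (λ d → T d i j) (e ℕ.+ f) ≈
        shift 0# (λ e → W e f i j) e + shift 0# (λ f → W e f i j) f
      odds zero    zero    = trans (•-zeroʳ _) (sym (+-identityˡ 0#))
      odds zero    (suc f) = sym (+-identityˡ _)
      odds (suc e) zero    = trans (reflexive (≡.cong (_• T (e ℕ.+ 0) i j) (w-diagonal e i j))) (sym (+-identityʳ _))
      odds (suc e) (suc f) = trans (•-congʳ (w-pascal e f i j)) (trans (•-distribʳ _ _ _)
        (+-congˡ (reflexive (≡.cong (λ d → w (suc e) f i j • T d i j) (ℕ.+-suc e f)))))

    W-evens : ∀ e f i j → w e f i j • (z (p ℕ.+ p) * shift 0# (T (e ℕ.+ f) i) j) ≈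
      b • (z (p ℕ.+ p) * shift 0# (W e f i) j)
    W-evens e f i zero    =
      trans (•-congˡ (zeroʳ _)) (trans (•-zeroʳ _) (sym (trans (•-congˡ (zeroʳ _)) (•-zeroʳ _))))
    W-evens e f i (suc j) =
      trans (•-congʳ (w-evens e f i j)) (trans (•-assoc _ _ _) (•-congˡ (sym (*-•-comm _ _ _))))

    W-larger : ∀ e f i j → w e f i j • (x ^ (p ℕ.+ p) * shift 0# (λ i → T (e ℕ.+ f) i j) i) ≈
      shift 0# (λ i → c • (x ^ (p ℕ.+ p) * W e f i j)) i
    W-larger e f zero    j = trans (•-congˡ (zeroʳ _)) (•-zeroʳ _)
    W-larger e f (suc i) j =
      trans (•-congʳ (w-larger e f i j)) (trans (•-assoc _ _ _) (•-congˡ (sym (*-•-comm _ _ _))))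

    -- The weighted form of `T-step`, with c replaced by the κ of the product's recursion. If some
    -- entry exists, the number of letters e + f + 2(i + j), with i already lowered, is positive and
    -- κ is c. The remaining case, the empty tuple, is treated separately, which is why the number
    -- of entries e + f + j becomes an argument of `go`.
    W-step : ∀ m e f i j → e ℕ.+ f ℕ.+ (i ℕ.+ j) ≡ suc m → W e f i j ≈
        z p * (shift 0# (λ e → W e f i j) e + shift 0# (λ f → W e f i j) f)
      + (b • (z (p ℕ.+ p) * shift 0# (W e f i) j)
      + shift 0# (λ i → κ (e ℕ.+ f ℕ.+ 2 ℕ.* (i ℕ.+ j)) • (x ^ (p ℕ.+ p) * W e f i j)) i)
    W-step m e f i j 1+m = go e f i j 1+m (e ℕ.+ f ℕ.+ j) ≡.refl
      where
      go : ∀ e f i j → e ℕ.+ f ℕ.+ (i ℕ.+ j) ≡ suc m → ∀ n → e ℕ.+ f ℕ.+ j ≡ n → W e f i j ≈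
          z p * (shift 0# (λ e → W e f i j) e + shift 0# (λ f → W e f i j) f)
        + (b • (z (p ℕ.+ p) * shift 0# (W e f i) j)
        + shift 0# (λ i → κ (e ℕ.+ f ℕ.+ 2 ℕ.* (i ℕ.+ j)) • (x ^ (p ℕ.+ p) * W e f i j)) i)
      go e f i j _ (suc N) N≡ = begin
        W e f i j
          ≈⟨ •-congˡ (T-step N (e ℕ.+ f) i j (≡.sym N≡)) ⟩
        w e f i j • (_ + (_ + _))
          ≈⟨ trans (•-distribˡ _ _ _) (+-congˡ (•-distribˡ _ _ _)) ⟩
        _ ≈⟨ +-cong (W-odds e f i j) (+-cong (W-evens e f i j) (trans (W-larger e f i j) (κ≈c i))) ⟩
        _ ∎
        where
        κ-positive : ∀ n i j → n ℕ.+ j ≡ suc N → κ (n ℕ.+ 2 ℕ.* (i ℕ.+ j)) ≡ c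
        κ-positive (suc n) i j       _ = ≡.refl
        κ-positive zero    i (suc j) _ = ≡.cong (λ n → κ (2 ℕ.* n)) (ℕ.+-suc i j)

        κ≈c : ∀ i → shift 0# (λ i → c • (x ^ (p ℕ.+ p) * W e f i j)) i ≈
          shift 0# (λ i → κ (e ℕ.+ f ℕ.+ 2 ℕ.* (i ℕ.+ j)) • (x ^ (p ℕ.+ p) * W e f i j)) i
        κ≈c = shift-cong (λ i → •-congʳ (K.reflexive (≡.sym (κ-positive (e ℕ.+ f) i j N≡))))
      -- No entry is left, so the left side vanishes, an empty tuple having no positive sum. On the
      -- right, i = 1 in `W` would leave a multiple of x^2p, and exactly there κ 0 = 0.
      go zero zero (suc i) zero _ zero _ = begin
        W 0 0 (suc i) 0
          ≈⟨ W-zero-suc i ⟩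
        0#
          ≈⟨ trans (+-cong (trans (*-congˡ (+-identityˡ 0#)) (zeroʳ _))
               (trans (+-cong (trans (•-congˡ (zeroʳ _)) (•-zeroʳ b)) (last i)) (+-identityˡ 0#))) (+-identityˡ 0#) ⟨
        _ ∎
        where
        last : ∀ i → κ (2 ℕ.* (i ℕ.+ 0)) • (x ^ (p ℕ.+ p) * W 0 0 i 0) ≈ 0#
        last zero    = •-zeroˡ _
        last (suc i) = trans (•-congˡ (trans (*-congˡ (W-zero-suc i)) (zeroʳ _))) (•-zeroʳ _)

    G : ℕ → ℕ → ℕ → Carrier
    G e f k = ∑ (antidiagonal k) (λ (i , j) → W e f i j)

    -- The last two terms of the product's recursion for two letters z_p, where r letters remain and
    -- h is the product of the remaining words.
    B : ℕ → Carrier → Carrier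
    B r h = b • (z (p ℕ.+ p) * h) + κ r • (x ^ (p ℕ.+ p) * h)

    B-+ : ∀ r g h → B r (g + h) ≈ B r g + B r h
    B-+ r g h = begin
      b • (z (p ℕ.+ p) * (g + h)) + κ r • (x ^ (p ℕ.+ p) * (g + h))
        ≈⟨ +-cong (trans (•-congˡ (distribˡ _ g h)) (•-distribˡ b _ _))
             (trans (•-congˡ (distribˡ _ g h)) (•-distribˡ (κ r) _ _)) ⟩
      (_ + _) + (_ + _)
        ≈⟨ solve 4 (λ k l m n → (k ⊕ l) ⊕ (m ⊕ n) ⊜ (k ⊕ m) ⊕ (l ⊕ n)) refl _ _ _ _ ⟩
      B r g + B r h
        ∎

    G-zero : G 0 0 0 ≈ 1#
    G-zero = trans (+-identityʳ _) (W-zero)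

    -- Summing `W-step` over i + j = k: lowering i and lowering j both become lowering k, and κ can
    -- be taken out of the sum because it depends on i and j through i + j only.
    G-step : ∀ m e f k → e ℕ.+ f ℕ.+ k ≡ suc m → G e f k ≈
        z p * (shift 0# (λ e → G e f k) e + shift 0# (λ f → G e f k) f)
      + shift 0# (λ k → B (e ℕ.+ f ℕ.+ 2 ℕ.* k) (G e f k)) k
    G-step m e f k 1+m = begin
      G e f k
        ≈⟨ ∑-cong-∈ (antidiagonal k) (λ { {i , j} ij∈ → W-step m e f i j
             (≡.trans (≡.cong (e ℕ.+ f ℕ.+_) (∈-antidiagonal k ij∈)) 1+m) }) ⟩
      ∑ (antidiagonal k) (λ (i , j) → z p * odds i j + (b • (z (p ℕ.+ p) * evens i j) + larger i j))
        ≈⟨ trans (∑-+ (antidiagonal k) _ _) (+-congˡ (∑-+ (antidiagonal k) _ _)) ⟩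
      ∑ (antidiagonal k) (λ (i , j) → z p * odds i j)
        + (∑ (antidiagonal k) (λ (i , j) → b • (z (p ℕ.+ p) * evens i j))
        + ∑ (antidiagonal k) (λ (i , j) → larger i j))
        ≈⟨ +-cong ∑-odds (+-cong ∑-evens ∑-larger) ⟩
      z p * (shift 0# (λ e → G e f k) e + shift 0# (λ f → G e f k) f)
        + (b • (z (p ℕ.+ p) * shift 0# (G e f) k)
        + shift 0# (λ k → κ (e ℕ.+ f ℕ.+ 2 ℕ.* k) • (x ^ (p ℕ.+ p) * G e f k)) k)
        ≈⟨ +-congˡ (combine k) ⟩
      z p * (shift 0# (λ e → G e f k) e + shift 0# (λ f → G e f k) f)
        + shift 0# (λ k → B (e ℕ.+ f ℕ.+ 2 ℕ.* k) (G e f k)) k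
        ∎
      where
      odds evens larger : ℕ → ℕ → Carrier
      odds i j   = shift 0# (λ e → W e f i j) e + shift 0# (λ f → W e f i j) f
      evens i j  = shift 0# (W e f i) j
      larger i j = shift 0# (λ i → κ (e ℕ.+ f ℕ.+ 2 ℕ.* (i ℕ.+ j)) • (x ^ (p ℕ.+ p) * W e f i j)) i

      ∑-odds : ∑ (antidiagonal k) (λ (i , j) → z p * odds i j) ≈
        z p * (shift 0# (λ e → G e f k) e + shift 0# (λ f → G e f k) f)
      ∑-odds = trans (sym (*-distribˡ-∑ (z p) (antidiagonal k) _)) (*-congˡ (trans (∑-+ (antidiagonal k) _ _)
        (+-cong (shift-∑ (antidiagonal k) (λ e (i , j) → W e f i j) e)
                (shift-∑ (antidiagonal k) (λ f (i , j) → W e f i j) f))))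

      ∑-evens : ∑ (antidiagonal k) (λ (i , j) → b • (z (p ℕ.+ p) * evens i j)) ≈
        b • (z (p ℕ.+ p) * shift 0# (G e f) k)
      ∑-evens = trans (sym (•-distribˡ-∑ b (antidiagonal k) _)) (•-congˡ
        (trans (sym (*-distribˡ-∑ _ (antidiagonal k) _)) (*-congˡ (∑-antidiagonal-shiftʳ k (W e f)))))

      ∑-larger : ∑ (antidiagonal k) (λ (i , j) → larger i j) ≈
        shift 0# (λ k → κ (e ℕ.+ f ℕ.+ 2 ℕ.* k) • (x ^ (p ℕ.+ p) * G e f k)) k
      ∑-larger = trans (∑-antidiagonal-shiftˡ k _) (shift-cong (λ k → trans
        (∑-cong-∈ (antidiagonal k) (λ {ij} ij∈ → reflexive (≡.cong
          (λ r → κ (e ℕ.+ f ℕ.+ 2 ℕ.* r) • (x ^ (p ℕ.+ p) * W e f (proj₁ ij) (proj₂ ij))) (∈-antidiagonal k ij∈))))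
        (trans (sym (•-distribˡ-∑ _ (antidiagonal k) _)) (•-congˡ (sym (*-distribˡ-∑ _ (antidiagonal k) _))))) k)

      combine : ∀ k → b • (z (p ℕ.+ p) * shift 0# (G e f) k)
        + shift 0# (λ k → κ (e ℕ.+ f ℕ.+ 2 ℕ.* k) • (x ^ (p ℕ.+ p) * G e f k)) k ≈
        shift 0# (λ k → B (e ℕ.+ f ℕ.+ 2 ℕ.* k) (G e f k)) k
      combine zero    = trans (+-identityʳ _) (trans (•-congˡ (zeroʳ _)) (•-zeroʳ b))
      combine (suc k) = refl

    -- U n v 0 is the closed form of the product of z_p^n and z_p^v.
    U : ℕ → ℕ → ℕ → Carrier
    U zero    v       k = G zero v k
    U (suc n) zero    k = G (suc n) zero k
    U (suc n) (suc v) k = G (suc n) (suc v) k + U n v (suc k)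

    U-zeroʳ : ∀ n k → U n 0 k ≡ G n 0 k
    U-zeroʳ zero    k = ≡.refl
    U-zeroʳ (suc n) k = ≡.refl

    -- The first point of the diagonal split off; the rest of the diagonal is present only if n is
    -- positive.
    U-sucʳ : ∀ n v k → U n (suc v) k ≈ G n (suc v) k + shift 0# (λ n → U n v (suc k)) n
    U-sucʳ zero    v k = sym (+-identityʳ _)
    U-sucʳ (suc n) v k = refl

    U-sucˡ : ∀ n v k → U (suc n) v k ≈ G (suc n) v k + shift 0# (λ v → U n v (suc k)) v
    U-sucˡ n zero    k = sym (+-identityʳ _)
    U-sucˡ n (suc v) k = refl

    -- The offset k in `U` serves this induction: the rest of a diagonal is again a `U`, with offset
    -- raised by 1. Since e + f + 2k is constant along the diagonal, all summands share the same κ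
    -- and their `B` terms add up to a single one.
    U-step : ∀ n v k → U n v (suc k) ≈
        z p * (shift 0# (λ n → U n v (suc k)) n + shift 0# (λ v → U n v (suc k)) v)
      + B (n ℕ.+ v ℕ.+ 2 ℕ.* k) (U n v k)
    U-step zero    v       k = G-step _ zero v (suc k) (ℕ.+-suc v k)
    U-step (suc n) zero    k = trans (G-step _ (suc n) zero (suc k) ≡.refl)
      (+-congʳ (*-congˡ (+-congʳ (reflexive (≡.sym (U-zeroʳ n (suc k)))))))
    U-step (suc n) (suc v) k = begin
      G (suc n) (suc v) (suc k) + U n v (2 ℕ.+ k)
        ≈⟨ +-cong (G-step _ (suc n) (suc v) (suc k) ≡.refl) (U-step n v (suc k)) ⟩
      (z p * (g₁ + g₂) + B r (G (suc n) (suc v) k)) + (z p * (u₁ + u₂) + B r′ (U n v (suc k)))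
        ≡⟨ ≡.cong (λ q → (z p * (g₁ + g₂) + B r (G (suc n) (suc v) k)) + (z p * (u₁ + u₂) + B q (U n v (suc k))))
             (degree n v k) ⟩
      (z p * (g₁ + g₂) + B r (G (suc n) (suc v) k)) + (z p * (u₁ + u₂) + B r (U n v (suc k)))
        ≈⟨ solve 4 (λ k l m n → (k ⊕ l) ⊕ (m ⊕ n) ⊜ (k ⊕ m) ⊕ (l ⊕ n)) refl _ _ _ _ ⟩
      (z p * (g₁ + g₂) + z p * (u₁ + u₂)) + (B r (G (suc n) (suc v) k) + B r (U n v (suc k)))
        ≈⟨ +-cong (distribˡ (z p) _ _) (B-+ r _ _) ⟨
      z p * ((g₁ + g₂) + (u₁ + u₂)) + B r (U (suc n) (suc v) k)
        ≈⟨ +-congʳ (*-congˡ (solve 4 (λ k l m n → (k ⊕ l) ⊕ (m ⊕ n) ⊜ (k ⊕ m) ⊕ (l ⊕ n)) refl _ _ _ _)) ⟩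
      z p * ((g₁ + u₁) + (g₂ + u₂)) + B r (U (suc n) (suc v) k)
        ≈⟨ +-congʳ (*-congˡ (+-cong (U-sucʳ n v (suc k)) (U-sucˡ n v (suc k)))) ⟨
      z p * (U n (suc v) (suc k) + U (suc n) v (suc k)) + B r (U (suc n) (suc v) k)
        ∎
      where
      g₁ = G n (suc v) (suc k)
      g₂ = G (suc n) v (suc k)
      u₁ = shift 0# (λ n → U n v (2 ℕ.+ k)) n
      u₂ = shift 0# (λ v → U n v (2 ℕ.+ k)) v
      r  = suc n ℕ.+ suc v ℕ.+ 2 ℕ.* k
      r′ = n ℕ.+ v ℕ.+ 2 ℕ.* suc k
      degree : ∀ n v k → n ℕ.+ v ℕ.+ 2 ℕ.* suc k ≡ suc n ℕ.+ suc v ℕ.+ 2 ℕ.* k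
      degree = solve-∀

    U₀-sucˡ : ∀ n → U (suc n) 0 0 ≈ z p * U n 0 0
    U₀-sucˡ n = begin
      G (suc n) 0 0                      ≈⟨ G-step _ (suc n) 0 0 ≡.refl ⟩
      z p * (G n 0 0 + 0#) + 0#          ≈⟨ trans (+-identityʳ _) (*-congˡ (+-identityʳ _)) ⟩
      z p * G n 0 0                      ≡⟨ ≡.cong (z p *_) (U-zeroʳ n 0) ⟨
      z p * U n 0 0                      ∎

    U₀-sucʳ : ∀ v → U 0 (suc v) 0 ≈ z p * U 0 v 0
    U₀-sucʳ v = begin
      G 0 (suc v) 0                      ≈⟨ G-step _ 0 (suc v) 0 ≡.refl ⟩
      z p * (0# + G 0 v 0) + 0#          ≈⟨ trans (+-identityʳ _) (*-congˡ (+-identityˡ _)) ⟩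
      z p * G 0 v 0                      ∎

    -- The first summand has k = 0 and hence no `B` term; the remaining ones form `U n v 1`, to
    -- which `U-step` applies. The index n + v of `B` is the number of letters left after removing
    -- one from each word, so it is 0 exactly when both remainders are empty.
    U₀-suc : ∀ n v → U (suc n) (suc v) 0 ≈
      z p * U n (suc v) 0 + z p * U (suc n) v 0 + B (n ℕ.+ v) (U n v 0)
    U₀-suc n v = begin
      G (suc n) (suc v) 0 + U n v 1
        ≈⟨ +-cong (trans (G-step _ (suc n) (suc v) 0 ≡.refl) (+-identityʳ _)) (U-step n v 0) ⟩
      z p * (g₁ + g₂) + (z p * (u₁ + u₂) + B (n ℕ.+ v ℕ.+ 0) (U n v 0))
        ≈⟨ +-assoc _ _ _ ⟨
      z p * (g₁ + g₂) + z p * (u₁ + u₂) + B (n ℕ.+ v ℕ.+ 0) (U n v 0)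
        ≈⟨ +-cong (sym (distribˡ (z p) _ _)) (reflexive (≡.cong (λ r → B r (U n v 0)) (ℕ.+-identityʳ (n ℕ.+ v)))) ⟩
      z p * ((g₁ + g₂) + (u₁ + u₂)) + B (n ℕ.+ v) (U n v 0)
        ≈⟨ +-congʳ (*-congˡ (solve 4 (λ k l m n → (k ⊕ l) ⊕ (m ⊕ n) ⊜ (k ⊕ m) ⊕ (l ⊕ n)) refl _ _ _ _)) ⟩
      z p * ((g₁ + u₁) + (g₂ + u₂)) + B (n ℕ.+ v) (U n v 0)
        ≈⟨ +-congʳ (trans (sym (distribˡ (z p) _ _)) (*-congˡ (+-cong (U-sucʳ n v 0) (U-sucˡ n v 0)))) ⟨
      z p * U n (suc v) 0 + z p * U (suc n) v 0 + B (n ℕ.+ v) (U n v 0)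
        ∎
      where
      g₁ = G n (suc v) 0
      g₂ = G (suc n) v 0
      u₁ = shift 0# (λ n → U n v 1) n
      u₂ = shift 0# (λ v → U n v 1) v

    U-∑ : ∀ n v k → U n v k ≈ ∑ (0 ⋯ (n ⊓ v)) (λ s → G (n ∸ s) (v ∸ s) (s ℕ.+ k))
    U-∑ zero    v       k = sym (+-identityʳ _)
    U-∑ (suc n) zero    k = sym (+-identityʳ _)
    U-∑ (suc n) (suc v) k = +-congˡ (begin
      U n v (suc k)
        ≈⟨ U-∑ n v (suc k) ⟩
      ∑ (0 ⋯ (n ⊓ v)) (λ s → G (n ∸ s) (v ∸ s) (s ℕ.+ suc k))
        ≈⟨ ∑-cong (0 ⋯ (n ⊓ v)) (λ s → reflexive (≡.cong (G (n ∸ s) (v ∸ s)) (ℕ.+-suc s k))) ⟩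
      ∑ (0 ⋯ (n ⊓ v)) (λ s → G (suc n ∸ suc s) (suc v ∸ suc s) (suc s ℕ.+ k))
        ≡⟨ ∑-applyUpTo suc (suc (n ⊓ v)) (λ s → G (suc n ∸ s) (suc v ∸ s) (s ℕ.+ k)) ⟨
      ∑ (applyUpTo suc (suc (n ⊓ v))) (λ s → G (suc n ∸ s) (suc v ∸ s) (s ℕ.+ k))
        ∎)

    -- Translates the indices of the theorem into e = n - k, f = v - k, i, j. As i + j = k and k is
    -- at most min(n, v), no subtraction is cut off. `N` and `M` are kept apart, with equations, to
    -- fit the different forms in which n + v occurs; `h` is the prefix in front of the tuples.
    ∑-expansion : ∀ n v N M → N ≡ n ℕ.+ v → M ≡ n ℕ.+ v → ∀ h →
      ∑ (0 ⋯ (n ⊓ v)) (λ k → ∑ (antidiagonal k) (λ (i , j) → ∑ (𝒜 p (N ∸ i ∸ k) M j) (λ a →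
        (fromℕ ((N ∸ 2 ℕ.* k) C (n ∸ k)) K.* c ^ᴷ i K.* b ^ᴷ j) • (h * z⃗ a)))) ≈
      h * U n v 0
    ∑-expansion n v _ _ ≡.refl ≡.refl h = begin
      ∑ (0 ⋯ (n ⊓ v)) (λ k → ∑ (antidiagonal k) (λ (i , j) → ∑ (𝒜 p (n ℕ.+ v ∸ i ∸ k) (n ℕ.+ v) j) (λ a →
        (fromℕ ((n ℕ.+ v ∸ 2 ℕ.* k) C (n ∸ k)) K.* c ^ᴷ i K.* b ^ᴷ j) • (h * z⃗ a))))
        ≈⟨ ∑-cong-∈ (0 ⋯ (n ⊓ v)) (λ {k} k∈ → ∑-cong-∈ (antidiagonal k) (λ { {i , j} ij∈ → term k i j k∈ ij∈ })) ⟩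
      ∑ (0 ⋯ (n ⊓ v)) (λ k → ∑ (antidiagonal k) (λ (i , j) → h * W (n ∸ k) (v ∸ k) i j))
        ≈⟨ ∑-cong (0 ⋯ (n ⊓ v)) (λ k → *-distribˡ-∑ h (antidiagonal k) _) ⟨
      ∑ (0 ⋯ (n ⊓ v)) (λ k → h * G (n ∸ k) (v ∸ k) k)
        ≈⟨ *-distribˡ-∑ h (0 ⋯ (n ⊓ v)) _ ⟨
      h * ∑ (0 ⋯ (n ⊓ v)) (λ k → G (n ∸ k) (v ∸ k) k)
        ≈⟨ *-congˡ (∑-cong (0 ⋯ (n ⊓ v)) (λ k → reflexive (≡.cong (G (n ∸ k) (v ∸ k)) (≡.sym (ℕ.+-identityʳ k))))) ⟩
      h * ∑ (0 ⋯ (n ⊓ v)) (λ k → G (n ∸ k) (v ∸ k) (k ℕ.+ 0))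
        ≈⟨ *-congˡ (U-∑ n v 0) ⟨
      h * U n v 0
        ∎
      where
      term : ∀ k i j → k ∈ (0 ⋯ (n ⊓ v)) → (i , j) ∈ antidiagonal k →
        ∑ (𝒜 p (n ℕ.+ v ∸ i ∸ k) (n ℕ.+ v) j) (λ a →
          (fromℕ ((n ℕ.+ v ∸ 2 ℕ.* k) C (n ∸ k)) K.* c ^ᴷ i K.* b ^ᴷ j) • (h * z⃗ a)) ≈
        h * W (n ∸ k) (v ∸ k) i j
      term k i j k∈ ij∈ with _ , s≤s k≤ , ≡.refl ← ∈-applyUpTo⁻ id k∈ = begin
        ∑ (𝒜 p (n ℕ.+ v ∸ i ∸ k) (n ℕ.+ v) j) (λ a → coefficient (n ℕ.+ v ∸ 2 ℕ.* k) • (h * z⃗ a))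
          ≡⟨ ≡.cong₂ (λ N M → ∑ (𝒜 p N M j) (λ a → coefficient (n ℕ.+ v ∸ 2 ℕ.* k) • (h * z⃗ a))) N≡ M≡ ⟩
        ∑ as (λ a → coefficient (n ℕ.+ v ∸ 2 ℕ.* k) • (h * z⃗ a))
          ≡⟨ ≡.cong (λ d → ∑ as (λ a → coefficient d • (h * z⃗ a))) d≡ ⟩
        ∑ as (λ a → coefficient d • (h * z⃗ a))
          ≈⟨ ∑-cong as (λ a → *-•-comm _ h (z⃗ a)) ⟨
        ∑ as (λ a → h * (coefficient d • z⃗ a))
          ≈⟨ *-distribˡ-∑ h as _ ⟨
        h * ∑ as (λ a → coefficient d • z⃗ a)
          ≈⟨ *-congˡ (•-distribˡ-∑ _ as z⃗) ⟨
        h * W (n ∸ k) (v ∸ k) i j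
          ∎
        where
        d : ℕ
        d = (n ∸ k) ℕ.+ (v ∸ k)

        as : List (Vec ℕ (d ℕ.+ j))
        as = 𝒜 p (d ℕ.+ j) (d ℕ.+ 2 ℕ.* (i ℕ.+ j)) j

        coefficient : ℕ → K.Carrier
        coefficient d = fromℕ (d C (n ∸ k)) K.* c ^ᴷ i K.* b ^ᴷ j

        i+j≡k : i ℕ.+ j ≡ k
        i+j≡k = ∈-antidiagonal k ij∈

        d+2k : n ℕ.+ v ≡ d ℕ.+ 2 ℕ.* k
        d+2k = ≡.trans (≡.cong₂ ℕ._+_ (≡.sym (ℕ.m∸n+n≡m (ℕ.≤-trans k≤ (ℕ.m⊓n≤m n v))))
                                      (≡.sym (ℕ.m∸n+n≡m (ℕ.≤-trans k≤ (ℕ.m⊓n≤n n v)))))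
                 (rearrange (n ∸ k) (v ∸ k) k)
          where
          rearrange : ∀ e f k → e ℕ.+ k ℕ.+ (f ℕ.+ k) ≡ e ℕ.+ f ℕ.+ 2 ℕ.* k
          rearrange = solve-∀

        d≡ : n ℕ.+ v ∸ 2 ℕ.* k ≡ d
        d≡ = ≡.trans (≡.cong (_∸ 2 ℕ.* k) d+2k) (ℕ.m+n∸n≡m d (2 ℕ.* k))

        M≡ : n ℕ.+ v ≡ d ℕ.+ 2 ℕ.* (i ℕ.+ j)
        M≡ = ≡.trans d+2k (≡.cong (λ k → d ℕ.+ 2 ℕ.* k) (≡.sym i+j≡k))

        N≡ : n ℕ.+ v ∸ i ∸ k ≡ d ℕ.+ j
        N≡ = ≡.trans (ℕ.∸-+-assoc (n ℕ.+ v) i k) (≡.trans (≡.cong (_∸ (i ℕ.+ k)) (≡.trans M≡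
               (≡.trans (rearrange d i j) (≡.cong (λ k → d ℕ.+ j ℕ.+ (i ℕ.+ k)) i+j≡k)))) (ℕ.m+n∸n≡m (d ℕ.+ j) (i ℕ.+ k)))
          where
          rearrange : ∀ d i j → d ℕ.+ 2 ℕ.* (i ℕ.+ j) ≡ d ℕ.+ j ℕ.+ (i ℕ.+ (i ℕ.+ j))
          rearrange = solve-∀

-- Reduction of the full product to products of two powers of z_p

module Stuffle (𝔸 : Algebra) (x y : Ring.Carrier (Algebra.ring 𝔸))
  (b c : CommutativeRing.Carrier (Algebra.scalars 𝔸))
  (stuffle : List ℕ → List ℕ → Ring.Carrier (Algebra.ring 𝔸)) where

  open Algebra 𝔸
  open Ring ring hiding (zero)
  open Sums ring
  open SetoidReasoning setoid
  open RawSemiringDefs (Semiring.rawSemiring semiring) using (_^_)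
  open RawSemiringDefs (Semiring.rawSemiring K.semiring) using () renaming (_^_ to _^ᴷ_)
  open CommutativeMonoidSolver +-commutativeMonoid using (solve; _⊜_; _⊕_)
  open TupleSums 𝔸 x y b c

  δ₁ : List ℕ → K.Carrier
  δ₁ ks = if null ks then K.1# else K.0#

  record IsStuffle : Set where
    field
      stuffle-[]ˡ : ∀ ls → stuffle [] ls ≈ z-product ls
      stuffle-[]ʳ : ∀ ks → stuffle ks [] ≈ z-product ks
      stuffle-∷   : ∀ k ks l ls → stuffle (k ∷ ks) (l ∷ ls) ≈
          z k * stuffle ks (l ∷ ls)
        + z l * stuffle (k ∷ ks) ls
        + b • (z (k ℕ.+ l) * stuffle ks ls)
        + ((K.1# K.- δ₁ ks K.* δ₁ ls) K.* c) • (x ^ (k ℕ.+ l) * stuffle ks ls)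

  module _ (isStuffle : IsStuffle) where
    open IsStuffle isStuffle

    -- The recursion is symmetric: its first two terms are exchanged and the other two are fixed.
    -- This gives the second sum of the theorem from the first.
    stuffle-comm : ∀ ks ls → stuffle ks ls ≈ stuffle ls ks
    stuffle-comm []       ls       = trans (stuffle-[]ˡ ls) (sym (stuffle-[]ʳ ls))
    stuffle-comm (k ∷ ks) []       = trans (stuffle-[]ʳ (k ∷ ks)) (sym (stuffle-[]ˡ (k ∷ ks)))
    stuffle-comm (k ∷ ks) (l ∷ ls) = begin
      stuffle (k ∷ ks) (l ∷ ls)
        ≈⟨ stuffle-∷ k ks l ls ⟩
      _ ≈⟨ +-cong (+-cong (trans (+-comm _ _)
               (+-cong (*-congˡ (stuffle-comm (k ∷ ks) ls)) (*-congˡ (stuffle-comm ks (l ∷ ls)))))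
             (•-congˡ (*-cong (reflexive (≡.cong z (ℕ.+-comm k l))) (stuffle-comm ks ls))))
             (•-cong (K.*-congʳ (K.+-congˡ (K.-‿cong (K.*-comm _ _))))
               (*-cong (reflexive (≡.cong (x ^_) (ℕ.+-comm k l))) (stuffle-comm ks ls))) ⟩
      _ ≈⟨ stuffle-∷ l ls k ks ⟨
      stuffle (l ∷ ls) (k ∷ ks)
        ∎

    δ₁-replicate : ∀ n (a : ℕ) → δ₁ (replicate n a) ≡ δ n 0
    δ₁-replicate zero    a = ≡.refl
    δ₁-replicate (suc n) a = ≡.refl

    1-0≈ : ∀ {d} → d K.≈ K.0# → (K.1# K.- d) K.* c K.≈ c
    1-0≈ d≈0 = K.trans (K.*-congʳ (K.trans (K.+-congˡ (K.trans (K.-‿cong d≈0) -0#≈0#)) (K.+-identityʳ _)))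
      (K.*-identityˡ c)
      where open RingProperties K.ring using (-0#≈0#)

    1-δδ≈κ : ∀ n v → (K.1# K.- δ n 0 K.* δ v 0) K.* c K.≈ κ (n ℕ.+ v)
    1-δδ≈κ zero    zero    = K.trans
      (K.*-congʳ (K.trans (K.+-congˡ (K.-‿cong (K.*-identityˡ _))) (K.-‿inverseʳ _))) (K.zeroˡ c)
    1-δδ≈κ zero    (suc v) = 1-0≈ (K.zeroʳ _)
    1-δδ≈κ (suc n) v       = 1-0≈ (K.zeroˡ _)

    module _ (p : ℕ) (0<p : 0 < p) where

      pw : ℕ → List ℕ
      pw n = replicate n p

      1-δ₁δ₁≈ : ∀ n v → (K.1# K.- δ₁ (pw n) K.* δ₁ (pw v)) K.* c ≡ (K.1# K.- δ n 0 K.* δ v 0) K.* c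
      1-δ₁δ₁≈ n v = ≡.cong₂ (λ d d′ → (K.1# K.- d K.* d′) K.* c) (δ₁-replicate n p) (δ₁-replicate v p)

      stuffle-powers : ∀ n v → stuffle (pw n) (pw v) ≈ U p 0<p n v 0
      stuffle-powers zero    zero    = trans (stuffle-[]ˡ []) (sym (G-zero p 0<p))
      stuffle-powers zero    (suc v) = begin
        stuffle [] (pw (suc v))        ≈⟨ stuffle-[]ˡ (pw (suc v)) ⟩
        z p * z-product (pw v)         ≈⟨ *-congˡ (stuffle-[]ˡ (pw v)) ⟨
        z p * stuffle [] (pw v)        ≈⟨ *-congˡ (stuffle-powers zero v) ⟩
        z p * U p 0<p 0 v 0            ≈⟨ U₀-sucʳ p 0<p v ⟨
        U p 0<p 0 (suc v) 0            ∎
      stuffle-powers (suc n) zero    = begin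
        stuffle (pw (suc n)) []        ≈⟨ stuffle-[]ʳ (pw (suc n)) ⟩
        z p * z-product (pw n)         ≈⟨ *-congˡ (stuffle-[]ʳ (pw n)) ⟨
        z p * stuffle (pw n) []        ≈⟨ *-congˡ (stuffle-powers n zero) ⟩
        z p * U p 0<p n 0 0            ≈⟨ U₀-sucˡ p 0<p n ⟨
        U p 0<p (suc n) 0 0            ∎
      stuffle-powers (suc n) (suc v) = begin
        stuffle (pw (suc n)) (pw (suc v))
          ≈⟨ stuffle-∷ p (pw n) p (pw v) ⟩
        _ ≈⟨ +-cong (+-cong (+-cong (*-congˡ (stuffle-powers n (suc v))) (*-congˡ (stuffle-powers (suc n) v)))
               (•-congˡ (*-congˡ (stuffle-powers n v))))
               (•-cong (K.trans (K.reflexive (1-δ₁δ₁≈ n v)) (1-δδ≈κ n v)) (*-congˡ (stuffle-powers n v))) ⟩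
        _ ≈⟨ +-assoc _ _ _ ⟩
        _ ≈⟨ U₀-suc p 0<p n v ⟨
        U p 0<p (suc n) (suc v) 0
          ∎

      module _ (u : ℕ) where

        -- What precedes the product of z_p^(n-l) and z_p^v when exactly l letters z_p are used by
        -- the time z_u is: z_u follows the l-th z_p, or is merged with it in one of two ways. The
        -- exceptional coefficient vanishes when n = l and v = 0, that is, when nothing remains.
        D : ℕ → ℕ → ℕ → Carrier
        D n v l = z p ^ l * z u
          + b • (z p ^ (l ∸ 1) * z (u ℕ.+ p))
          + ((K.1# K.- δ v 0 K.* δ n l) K.* c) • (z p ^ (l ∸ 1) * x ^ (u ℕ.+ p))

        -- Only positive indices are shifted, since at 0 the truncated exponent `l ∸ 1` would not
        -- increase by 1.
        D-suc : ∀ n v l → z p * D n v (suc l) ≈ D (suc n) v (suc (suc l))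
        D-suc n v l = trans (distribˡ _ _ _) (+-cong (trans (distribˡ _ _ _)
          (+-cong (sym (*-assoc _ _ _))
            (trans (*-•-comm _ _ _) (•-congˡ (sym (*-assoc _ _ _))))))
          (trans (*-•-comm _ _ _) (•-congˡ (sym (*-assoc _ _ _)))))

        D-one : ∀ n v h → D (suc n) v 1 * h ≈
            z p * (z u * h)
          + b • (z (p ℕ.+ u) * h)
          + ((K.1# K.- δ n 0 K.* δ v 0) K.* c) • (x ^ (p ℕ.+ u) * h)
        D-one n v h = trans (distribʳ _ _ _) (+-cong (trans (distribʳ _ _ _)
          (+-cong (trans (*-assoc _ _ _) (*-congʳ (*-identityʳ _)))
            (trans (•-*-assoc _ _ _) (•-congˡ
              (*-congʳ (trans (*-identityˡ _) (reflexive (≡.cong z (ℕ.+-comm u p)))))))))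
          (trans (•-*-assoc _ _ _) (•-cong (K.*-congʳ (K.+-congˡ (K.-‿cong (K.*-comm _ _))))
            (*-congʳ (trans (*-identityˡ _) (reflexive (≡.cong (x ^_) (ℕ.+-comm u p))))))))

        -- Sorts the terms by the number l of letters z_p used up together with or before z_u. The
        -- case l = 0 is kept apart, because it contributes to the third sum of the theorem.
        stuffle-power : ∀ n v → stuffle (pw n) (u ∷ pw v) ≈
          ∑ (1 ⋯ n) (λ l → D n v l * stuffle (pw (n ∸ l)) (pw v)) + z u * stuffle (pw n) (pw v)
        stuffle-power zero    v = begin
          stuffle [] (u ∷ pw v)            ≈⟨ stuffle-[]ˡ (u ∷ pw v) ⟩
          z u * z-product (pw v)           ≈⟨ *-congˡ (stuffle-[]ˡ (pw v)) ⟨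
          z u * stuffle [] (pw v)          ≈⟨ +-identityˡ _ ⟨
          0# + z u * stuffle [] (pw v)     ∎
        stuffle-power (suc n) v = begin
          stuffle (pw (suc n)) (u ∷ pw v)
            ≈⟨ stuffle-∷ p (pw n) u (pw v) ⟩
          z p * stuffle (pw n) (u ∷ pw v) + z u * stuffle (pw (suc n)) (pw v) + b • (z (p ℕ.+ u) * st)
            + ((K.1# K.- δ₁ (pw n) K.* δ₁ (pw v)) K.* c) • (x ^ (p ℕ.+ u) * st)
            ≈⟨ +-cong (+-congʳ (+-congʳ (trans (*-congˡ (stuffle-power n v)) (distribˡ _ _ _))))
                 (•-congʳ (K.reflexive (1-δ₁δ₁≈ n v))) ⟩
          z p * s + z p * (z u * st) + z u * stuffle (pw (suc n)) (pw v) + b • (z (p ℕ.+ u) * st)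
            + ((K.1# K.- δ n 0 K.* δ v 0) K.* c) • (x ^ (p ℕ.+ u) * st)
            -- The term z_p z_u and the two merged terms form the summand l = 1; prefixing z_p to
            -- the old sum gives the summands from l = 2 on.
            ≈⟨ solve 5 (λ s₁ s₂ s₃ s₄ s₅ → (((s₁ ⊕ s₂) ⊕ s₃) ⊕ s₄) ⊕ s₅ ⊜ (((s₂ ⊕ s₄) ⊕ s₅) ⊕ s₁) ⊕ s₃) refl _ _ _ _ _ ⟩
          (z p * (z u * st) + b • (z (p ℕ.+ u) * st) + ((K.1# K.- δ n 0 K.* δ v 0) K.* c) • (x ^ (p ℕ.+ u) * st))
            + z p * s + z u * stuffle (pw (suc n)) (pw v)
            ≈⟨ +-congʳ (+-cong (sym (D-one n v st)) shifted) ⟩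
          ∑ (1 ⋯ suc n) (λ l → D (suc n) v l * stuffle (pw (suc n ∸ l)) (pw v)) + z u * stuffle (pw (suc n)) (pw v)
            ∎
          where
          st = stuffle (pw n) (pw v)
          s  = ∑ (1 ⋯ n) (λ l → D n v l * stuffle (pw (n ∸ l)) (pw v))

          shifted : z p * s ≈
            ∑ (applyUpTo (2 ℕ.+_) n) (λ l → D (suc n) v l * stuffle (pw (suc n ∸ l)) (pw v))
          shifted = begin
            z p * s
              ≈⟨ *-distribˡ-∑ (z p) (1 ⋯ n) _ ⟩
            ∑ (1 ⋯ n) (λ l → z p * (D n v l * stuffle (pw (n ∸ l)) (pw v)))
              ≡⟨ ∑-applyUpTo suc n _ ⟩
            ∑ (applyUpTo id n) (λ l → z p * (D n v (suc l) * stuffle (pw (n ∸ suc l)) (pw v)))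
              ≈⟨ ∑-cong (applyUpTo id n) (λ l → trans (sym (*-assoc _ _ _)) (*-congʳ (D-suc n v l))) ⟩
            ∑ (applyUpTo id n) (λ l → D (suc n) v (2 ℕ.+ l) * stuffle (pw (suc n ∸ (2 ℕ.+ l))) (pw v))
              ≡⟨ ∑-applyUpTo (2 ℕ.+_) n _ ⟨
            ∑ (applyUpTo (2 ℕ.+_) n) (λ l → D (suc n) v l * stuffle (pw (suc n ∸ l)) (pw v))
              ∎

        ∑-stuffle-power : ∀ m n v →
          ∑ (1 ⋯ n) (λ l →
          ∑ (0 ⋯ (v ⊓ (n ∸ l))) (λ k →
          ∑ (antidiagonal k) (λ (i , j) →
          ∑ (𝒜 p (v ℕ.+ n ∸ l ∸ i ∸ k) (n ℕ.+ v ∸ l) j) (λ a →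
            (fromℕ ((v ℕ.+ n ∸ l ∸ 2 ℕ.* k) C (v ∸ k)) K.* c ^ᴷ i K.* b ^ᴷ j) • (z m * D n v l * z⃗ a)))))
          ≈ z m * ∑ (1 ⋯ n) (λ l → D n v l * stuffle (pw (n ∸ l)) (pw v))
        ∑-stuffle-power m n v = begin
          _ ≈⟨ ∑-cong-∈ (1 ⋯ n) (λ {l} l∈ → summand l l∈) ⟩
          ∑ (1 ⋯ n) (λ l → z m * (D n v l * stuffle (pw (n ∸ l)) (pw v)))
            ≈⟨ *-distribˡ-∑ (z m) (1 ⋯ n) _ ⟨
          z m * ∑ (1 ⋯ n) (λ l → D n v l * stuffle (pw (n ∸ l)) (pw v))
            ∎
          where
          summand : ∀ l → l ∈ (1 ⋯ n) →
            ∑ (0 ⋯ (v ⊓ (n ∸ l))) (λ k →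
            ∑ (antidiagonal k) (λ (i , j) →
            ∑ (𝒜 p (v ℕ.+ n ∸ l ∸ i ∸ k) (n ℕ.+ v ∸ l) j) (λ a →
              (fromℕ ((v ℕ.+ n ∸ l ∸ 2 ℕ.* k) C (v ∸ k)) K.* c ^ᴷ i K.* b ^ᴷ j) • (z m * D n v l * z⃗ a))))
            ≈ z m * (D n v l * stuffle (pw (n ∸ l)) (pw v))
          summand l l∈ with _ , l≤n , ≡.refl ← ∈-applyUpTo⁻ (1 ℕ.+_) l∈ = begin
            -- The binomial coefficient has v - k below, so the expansion is used with v in first
            -- place, and commutativity restores the order of the factors.
            _ ≈⟨ ∑-expansion p 0<p v (n ∸ l) (v ℕ.+ n ∸ l) (n ℕ.+ v ∸ l)
                   (ℕ.+-∸-assoc v l≤n) (≡.trans (≡.cong (_∸ l) (ℕ.+-comm n v)) (ℕ.+-∸-assoc v l≤n)) (z m * D n v l) ⟩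
            z m * D n v l * U p 0<p v (n ∸ l) 0
              ≈⟨ *-congˡ (trans (stuffle-comm (pw (n ∸ l)) (pw v)) (stuffle-powers v (n ∸ l))) ⟨
            z m * D n v l * stuffle (pw (n ∸ l)) (pw v)
              ≈⟨ *-assoc _ _ _ ⟩
            z m * (D n v l * stuffle (pw (n ∸ l)) (pw v))
              ∎

      -- After one step of the recursion, `stuffle-power` expands the products behind z_m and z_u.
      -- Their l = 0 terms, with prefixes z_m z_u and z_u z_m, join the two merged terms in the
      -- bracket of the third sum.
      stuffle-expansion : ∀ m u n v → stuffle (m ∷ pw n) (u ∷ pw v) ≈
          ∑ (1 ⋯ n) (λ l →
          ∑ (0 ⋯ (v ⊓ (n ∸ l))) (λ k →
          ∑ (antidiagonal k) (λ (i , j) →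
          ∑ (𝒜 p (v ℕ.+ n ∸ l ∸ i ∸ k) (n ℕ.+ v ∸ l) j) (λ a →
            (fromℕ ((v ℕ.+ n ∸ l ∸ 2 ℕ.* k) C (v ∸ k)) K.* c ^ᴷ i K.* b ^ᴷ j) • (z m * D u n v l * z⃗ a)))))
        + ∑ (1 ⋯ v) (λ l →
          ∑ (0 ⋯ (n ⊓ (v ∸ l))) (λ k →
          ∑ (antidiagonal k) (λ (i , j) →
          ∑ (𝒜 p (v ℕ.+ n ∸ l ∸ i ∸ k) (n ℕ.+ v ∸ l) j) (λ a →
            (fromℕ ((v ℕ.+ n ∸ l ∸ 2 ℕ.* k) C (n ∸ k)) K.* c ^ᴷ i K.* b ^ᴷ j) • (z u * D m v n l * z⃗ a)))))
        + ∑ (0 ⋯ (n ⊓ v)) (λ k →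
          ∑ (antidiagonal k) (λ (i , j) →
          ∑ (𝒜 p (v ℕ.+ n ∸ i ∸ k) (n ℕ.+ v) j) (λ a →
            (fromℕ ((v ℕ.+ n ∸ 2 ℕ.* k) C (n ∸ k)) K.* c ^ᴷ i K.* b ^ᴷ j) •
            ((z m * z u + z u * z m + b • z (m ℕ.+ u)
              + ((K.1# K.- δ n 0 K.* δ v 0) K.* c) • x ^ (m ℕ.+ u)) * z⃗ a))))
      stuffle-expansion m u n v = begin
        stuffle (m ∷ pw n) (u ∷ pw v)
          ≈⟨ stuffle-∷ m (pw n) u (pw v) ⟩
        z m * stuffle (pw n) (u ∷ pw v) + z u * stuffle (m ∷ pw n) (pw v) + b • (z (m ℕ.+ u) * st)
          + ((K.1# K.- δ₁ (pw n) K.* δ₁ (pw v)) K.* c) • (x ^ (m ℕ.+ u) * st)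
          ≈⟨ +-cong (+-cong (+-cong (split m (stuffle-power u n v)) (split u swapped)) (sym (•-*-assoc _ _ _)))
               (trans (•-congʳ (K.reflexive (1-δ₁δ₁≈ n v))) (sym (•-*-assoc _ _ _))) ⟩
        (z m * s + z m * z u * st) + (z u * s′ + z u * z m * st) + (b • z (m ℕ.+ u)) * st
          + (((K.1# K.- δ n 0 K.* δ v 0) K.* c) • x ^ (m ℕ.+ u)) * st
          ≈⟨ solve 6 (λ s₁ s₂ s₃ s₄ s₅ s₆ → (((s₁ ⊕ s₂) ⊕ (s₃ ⊕ s₄)) ⊕ s₅) ⊕ s₆ ⊜ (s₁ ⊕ s₃) ⊕ (((s₂ ⊕ s₄) ⊕ s₅) ⊕ s₆))
               refl _ _ _ _ _ _ ⟩
        _ ≈⟨ +-congˡ (sym (trans (distribʳ _ _ _) (+-congʳ (trans (distribʳ _ _ _) (+-congʳ (distribʳ _ _ _)))))) ⟩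
        z m * s + z u * s′ + (z m * z u + z u * z m + b • z (m ℕ.+ u)
              + ((K.1# K.- δ n 0 K.* δ v 0) K.* c) • x ^ (m ℕ.+ u)) * st
          ≈⟨ +-cong (+-cong (sym (∑-stuffle-power u m n v)) (sym second)) (sym third) ⟩
        _ ∎
        where
        st = stuffle (pw n) (pw v)
        s  = ∑ (1 ⋯ n) (λ l → D u n v l * stuffle (pw (n ∸ l)) (pw v))
        s′ = ∑ (1 ⋯ v) (λ l → D m v n l * stuffle (pw (v ∸ l)) (pw n))

        split : ∀ k {f g h} → f ≈ g + h * st → z k * f ≈ z k * g + z k * h * st
        split k f≈g+h = trans (*-congˡ f≈g+h) (trans (distribˡ _ _ _) (+-congˡ (sym (*-assoc _ _ _))))

        swapped : stuffle (m ∷ pw n) (pw v) ≈ s′ + z m * st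
        swapped = trans (stuffle-comm (m ∷ pw n) (pw v)) (trans (stuffle-power m v n)
          (+-congˡ (*-congˡ (stuffle-comm (pw v) (pw n)))))

        second :
          ∑ (1 ⋯ v) (λ l →
          ∑ (0 ⋯ (n ⊓ (v ∸ l))) (λ k →
          ∑ (antidiagonal k) (λ (i , j) →
          ∑ (𝒜 p (v ℕ.+ n ∸ l ∸ i ∸ k) (n ℕ.+ v ∸ l) j) (λ a →
            (fromℕ ((v ℕ.+ n ∸ l ∸ 2 ℕ.* k) C (n ∸ k)) K.* c ^ᴷ i K.* b ^ᴷ j) • (z u * D m v n l * z⃗ a)))))
          ≈ z u * s′
        -- Exchanging the roles of (m, n) and (u, v) also turns v + n and n + v around, which is
        -- undone here.
        second = trans (reflexive (≡.cong₂ (λ N M →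
          ∑ (1 ⋯ v) (λ l →
          ∑ (0 ⋯ (n ⊓ (v ∸ l))) (λ k →
          ∑ (antidiagonal k) (λ (i , j) →
          ∑ (𝒜 p (N ∸ l ∸ i ∸ k) (M ∸ l) j) (λ a →
            (fromℕ ((N ∸ l ∸ 2 ℕ.* k) C (n ∸ k)) K.* c ^ᴷ i K.* b ^ᴷ j) • (z u * D m v n l * z⃗ a))))))
          (ℕ.+-comm v n) (ℕ.+-comm n v))) (∑-stuffle-power m u v n)

        third : _ ≈ (z m * z u + z u * z m + b • z (m ℕ.+ u)
              + ((K.1# K.- δ n 0 K.* δ v 0) K.* c) • x ^ (m ℕ.+ u)) * st
        third = trans (∑-expansion p 0<p n v (v ℕ.+ n) (n ℕ.+ v) (ℕ.+-comm v n) ≡.refl _)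
          (*-congˡ (sym (stuffle-powers n v)))

-- The algebra ℚ[t]⟨x, y⟩

open import Defs
open import Data.Nat.Base using (_+_; _*_)
open ≡ using (refl; trans; cong; cong₂)

module ℚ[t]ₚ = MonoidAlgebraProperties {ℚ.+-*-rawRing} ℚ.+-*-isCommutativeRing ℕ._≟_ ℕ.+-0-isMonoid

ℚ[t]-isCommutativeRing : IsCommutativeRing (RawRing._≈_ ℚ[t]-rawRing) _+ᵗ_ _*ᵗ_ -ᵗ_ 0ᵗ 1ᵗ
ℚ[t]-isCommutativeRing = record { isRing = ℚ[t]ₚ.isRing ; *-comm = ℚ[t]ₚ.⊠-comm ℕ.+-comm }

module ℌₚ = MonoidAlgebraProperties {ℚ[t]-rawRing} ℚ[t]-isCommutativeRing (≡-dec _≟ᴸ_) (++-isMonoid {A = Letter})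

ℌ-algebra : Algebra
ℌ-algebra = record
  { scalars    = record { isCommutativeRing = ℚ[t]-isCommutativeRing }
  ; ring       = record { isRing = ℌₚ.isRing }
  ; _•_        = _•_
  ; •-cong     = λ {a} {a′} {f} {f′} → ℌₚ.•-cong {a} {a′} f f′
  ; •-distribˡ = ℌₚ.•-distribˡ
  ; •-distribʳ = ℌₚ.•-distribʳ
  ; •-assoc    = ℌₚ.•-assoc
  ; •-identity = ℌₚ.•-identity
  ; •-zeroˡ    = ℌₚ.•-zeroˡ
  ; •-zeroʳ    = λ a → Ring.refl ℌ-ring {0ᴴ}
  ; •-*-assoc  = ℌₚ.•-⊠-assoc
  ; *-•-comm   = ℌₚ.⊠-•-comm
  }
  where
  ℌ-ring : Ring 0ℓ 0ℓ
  ℌ-ring = record { isRing = ℌₚ.isRing }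

private module H = Ring (Algebra.ring ℌ-algebra)

open ℌ-Algebra using (monomial)

z-word : ℕ → Word
z-word k = replicate (k ∸ 1) X ++ Y ∷ []

z-words : List ℕ → Word
z-words = concatMap z-word

-- Formal sums agree here as lists, since `1ᵗ *ᵗ 1ᵗ` computes to `1ᵗ`. Equality of lists can be
-- substituted into `⊛`, which is defined on the listed terms, without showing that `⊛` respects
-- `≈`.
x^≡monomial : ∀ k → x ^ k ≡ monomial (replicate k X)
x^≡monomial zero    = refl
x^≡monomial (suc k) = cong (x ·_) (x^≡monomial k)

z≡monomial : ∀ k → z k ≡ monomial (z-word k)
z≡monomial k = cong (_· y) (x^≡monomial (k ∸ 1))

z^≡monomial : ∀ p n → z p ^ n ≡ monomial (z-words (replicate n p))
z^≡monomial p zero    = refl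
z^≡monomial p (suc n) = cong₂ _·_ (z≡monomial p) (z^≡monomial p n)

factor-replicate : ∀ k w → factor (replicate k X ++ Y ∷ w) ≡ Maybe.map (suc k ∷_) (factor w)
factor-replicate zero    w = refl
factor-replicate (suc k) w rewrite factor-replicate k w with factor w
... | just _        = refl
... | nothing       = refl

-- Positivity is essential: `z-word 0` and `z-word 1` are the same word.
factor-z-words : ∀ {ks} → List.All (0 <_) ks → factor (z-words ks) ≡ just ks
factor-z-words List.[] = refl
factor-z-words (List._∷_ {suc k} {ks} _ 0<ks) = trans (cong factor (++-assoc (replicate k X) (Y ∷ []) (z-words ks)))
  (trans (factor-replicate k (z-words ks)) (cong (Maybe.map (suc k ∷_)) (factor-z-words 0<ks)))

stuffleʷ-z-words : ∀ {ks ls} → List.All (0 <_) ks → List.All (0 <_) ls →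
  stuffleʷ (z-words ks) (z-words ls) ≡ stuffle ks ls
stuffleʷ-z-words 0<ks 0<ls rewrite factor-z-words 0<ks | factor-z-words 0<ls = refl

⊛-monomial : ∀ w₁ w₂ → (monomial w₁ ⊛ monomial w₂) ≈ stuffleʷ w₁ w₂
⊛-monomial w₁ w₂ = H.trans {monomial w₁ ⊛ monomial w₂} {1ᵗ • s} {s}
  (H.trans {(1ᵗ • s ⊕ 0ᴴ) ⊕ 0ᴴ} {1ᵗ • s ⊕ 0ᴴ} {1ᵗ • s} (H.+-identityʳ (1ᵗ • s ⊕ 0ᴴ)) (H.+-identityʳ (1ᵗ • s)))
  (ℌₚ.•-identity s)
  where s = stuffleʷ w₁ w₂

⊛-z-powers : ∀ m u p n v → 0 < m → 0 < u → 0 < p →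
  (z m · z p ^ n ⊛ z u · z p ^ v) ≈ stuffle (m ∷ replicate n p) (u ∷ replicate v p)
⊛-z-powers m u p n v 0<m 0<u 0<p = ≡.subst₂ _≈_
  (≡.sym (cong₂ _⊛_ (cong₂ _·_ (z≡monomial m) (z^≡monomial p n)) (cong₂ _·_ (z≡monomial u) (z^≡monomial p v))))
  (stuffleʷ-z-words (0<m List.∷ List.replicate⁺ n 0<p) (0<u List.∷ List.replicate⁺ v 0<p))
  (⊛-monomial (z-words (m ∷ replicate n p)) (z-words (u ∷ replicate v p)))

private module ℌ-Stuffle = Stuffle ℌ-algebra x y 1-2t t²-t stuffle

stuffle-isStuffle : ℌ-Stuffle.IsStuffle
stuffle-isStuffle = record
  { stuffle-[]ˡ = λ ls → H.refl {z-product ls}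
  ; stuffle-[]ʳ = stuffle-[]
  ; stuffle-∷   = λ k ks l ls → H.refl {stuffle (k ∷ ks) (l ∷ ls)}
  }
  where
  stuffle-[] : ∀ ks → stuffle ks [] ≈ z-product ks
  stuffle-[] []       = H.refl {z-product []}
  stuffle-[] (k ∷ ks) = H.refl {z-product (k ∷ ks)}

theorem1 : (m u p n v : ℕ) → 2 ≤ m → 2 ≤ u → 1 ≤ p →
    (z m · z p ^ n ⊛ z u · z p ^ v)
    ≈
    ( ∑ (1 ⋯ n) (λ l →
    ∑ (0 ⋯ (v ⊓ (n ∸ l))) (λ k →
    ∑ (antidiagonal k) (λ (i , j) →
    ∑ (𝒜 p (v + n ∸ l ∸ i ∸ k) (n + v ∸ l) j) (λ a →
    (fromℕ ((v + n ∸ l ∸ 2 * k) C (v ∸ k)) *ᵗ t²-t ^ᵗ i *ᵗ 1-2t ^ᵗ j) •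
    (z m
    · ( z p ^ l · z u
    ⊕ 1-2t • (z p ^ (l ∸ 1) · z (u + p))
    ⊕ ((1ᵗ -ᵗ δ v 0 *ᵗ δ n l) *ᵗ t²-t) • (z p ^ (l ∸ 1) · x ^ (u + p)))
    · z⃗ a)))))
    ⊕ ∑ (1 ⋯ v) (λ l →
    ∑ (0 ⋯ (n ⊓ (v ∸ l))) (λ k →
    ∑ (antidiagonal k) (λ (i , j) →
    ∑ (𝒜 p (v + n ∸ l ∸ i ∸ k) (n + v ∸ l) j) (λ a →
    (fromℕ ((v + n ∸ l ∸ 2 * k) C (n ∸ k)) *ᵗ t²-t ^ᵗ i *ᵗ 1-2t ^ᵗ j) •
    (z u
    · ( z p ^ l · z m
    ⊕ 1-2t • (z p ^ (l ∸ 1) · z (m + p))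
    ⊕ ((1ᵗ -ᵗ δ n 0 *ᵗ δ v l) *ᵗ t²-t) • (z p ^ (l ∸ 1) · x ^ (m + p)))
    · z⃗ a)))))
    ⊕ ∑ (0 ⋯ (n ⊓ v)) (λ k →
    ∑ (antidiagonal k) (λ (i , j) →
    ∑ (𝒜 p (v + n ∸ i ∸ k) (n + v) j) (λ a →
    (fromℕ ((v + n ∸ 2 * k) C (n ∸ k)) *ᵗ t²-t ^ᵗ i *ᵗ 1-2t ^ᵗ j) •
    (( z m · z u
    ⊕ z u · z m
    ⊕ 1-2t • z (m + u)
    ⊕ ((1ᵗ -ᵗ δ n 0 *ᵗ δ v 0) *ᵗ t²-t) • x ^ (m + u))
    · z⃗ a))))
    )
-- Equality in ℌ is equality at every word `w`, and equality in ℚ[t] is equality at every power `i`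
-- of t, so the two steps are composed as equalities of rational numbers.
theorem1 m u p n v 2≤m 2≤u 0<p w i = trans
  (⊛-z-powers m u p n v (ℕ.≤-trans (s≤s z≤n) 2≤m) (ℕ.≤-trans (s≤s z≤n) 2≤u) 0<p w i)
  (ℌ-Stuffle.stuffle-expansion stuffle-isStuffle p 0<p m u n v w i)
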